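{- For every $n\ge 1$ the genus distribution of ${\cal S}_4^n$ is log-concave. If $n=3$ its modes are $1$ and $2$; for every other $n\ge 1$ it has the single mode $$p_4(n)=\Big[\frac{n}{3}\Big]+1.$$
   Context: $[x]$ denotes the largest integer not exceeding $x$. A surface is represented by a cyclic word in which every occurring letter $x$ appears exactly once as $x$ and exactly once as $x^-$; it is the closed orientable surface obtained from a polygon with boundary labelled by the word by identifying each side $x$ with the side $x^-$ (orientation reversed), and its genus is the genus of that surface. Let $a,a_1,a_2,\dots$ be distinct letters. For $n\ge 1$ and subsets $K,T\subseteq\{1,\dots,n\}$ put: $R_1^n$ = product of the letters $a_k$, $k\in K$, in decreasing order of index; $R_2^n$ = product of the $a_k$, $k\notin K$, in increasing order of index; $R_3^n$ = product of the $a_t^-$, $t\in T$, in decreasing order of index; $R_4^n$ = product of the $a_t^-$, $t\notin T$, in increasing order of index. The set of ladder surfaces considered is ${\cal S}_4^n=\{aR_1^nR_2^na^-R_3^nR_4^n\}$, where $(K,T)$ runs over all $4^n$ pairs of subsets and surfaces are counted with multiplicity (one for each pair). The genus distribution of ${\cal S}_4^n$ is the sequence $(g_{i_4}(n))_i$, where $g_{i_4}(n)$ is the number of surfaces of genus $i$ in ${\cal S}_4^n$ and $i$ runs from the minimum to the maximum genus. A finite sequence of nonnegative numbers is log-concave if $a_i^2\ge a_{i-1}a_{i+1}$ for all interior indices $i$. It is unimodal if $a_q\le\cdots\le a_{l-1}<a_l=\cdots=a_m>a_{m+1}\ge\cdots\ge a_n$ for some $q\le l\le m\le n$; the indices $l,\dots,m$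 (genera) are its modes. -}

module Defs where

open import Data.Bool using (if_then_else_)
open import Data.Fin using (Fin; toℕ)
import Data.Fin as Fin
import Data.Fin.Properties as Fin
open import Data.Fin.Subset using (Subset; inside; outside)
open import Data.Fin.Subset.Properties using (_∈?_)
open import Data.Integer using (ℤ; +_)
import Data.Integer as ℤ
open import Data.List using (List; []; _∷_; _++_; allFin; cartesianProduct; cartesianProductWith; deduplicate; filter; length; lookup; map; reverse)
open import Data.List.Membership.Propositional using (_∈_)
open import Data.List.Membership.Propositional.Properties using (∈-allFin; ∈-cartesianProduct⁺; ∈-filter⁺)
open import Data.List.Relation.Unary.All using (All; []; _∷_)
open import Data.List.Relation.Unary.All.Properties using (all-filter)
open import Data.List.Relation.Unary.Any using (here; there)
open import Data.Nat using (ℕ; zero; suc; _+_; _*_; _^_; _≤_; _<_)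
open import Data.Nat.DivMod using (_mod_)
open import Data.Product using (_×_; _,_; proj₁; proj₂; uncurry)
import Data.Product.Properties as Product
open import Data.Sign using (Sign; opposite)
import Data.Sign as Sign
import Data.Sign.Properties as Sign
open import Data.Vec using (Vec)
import Data.Vec as Vec
import Data.Vec.Properties as Vec
open import Level using (0ℓ)
open import Relation.Binary using (Rel; Decidable; DecidableEquality)
open import Relation.Binary.Construct.Closure.Equivalence using (EqClosure; gfold; return; reflexive; symmetric; transitive)
open import Relation.Binary.PropositionalEquality using (_≡_; refl; sym; trans; cong; isEquivalence)
open import Relation.Nullary using (Dec; yes; no; ¬?; does; contradiction; _×-dec_)
open import Relation.Nullary.Decidable using (map′)

-- Deciding the equivalence relation generated by a decidable relation on a
-- finite set: start with distinct labels and merge the labels of related points.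

module _ {n : ℕ} where

  relabel : Fin n → Fin n → Fin n → Fin n
  relabel a b c = if does (c Fin.≟ a) then b else c

  labels : List (Fin n × Fin n) → Vec (Fin n) n
  labels []             = Vec.allFin n
  labels ((u , v) ∷ es) = Vec.map (relabel (Vec.lookup f u) (Vec.lookup f v)) f
    where f = labels es

  label : List (Fin n × Fin n) → Fin n → Fin n
  label es = Vec.lookup (labels es)

  label-∷ : ∀ u v es x →
            label ((u , v) ∷ es) x ≡ relabel (label es u) (label es v) (label es x)
  label-∷ u v es x = Vec.lookup-map x _ (labels es)

  relabel-source : ∀ a b → relabel a b a ≡ b
  relabel-source a b with a Fin.≟ a
  ... | yes _  = refl
  ... | no a≢a = contradiction refl a≢a

  relabel-target : ∀ a b → relabel a b b ≡ b
  relabel-target a b with b Fin.≟ a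
  ... | yes _ = refl
  ... | no  _ = refl

  label-complete : ∀ {u v es} → (u , v) ∈ es → label es u ≡ label es v
  label-complete {u} {v} {_ ∷ es} (here refl) =
    trans (trans (label-∷ u v es u) (relabel-source (label es u) _))
          (sym (trans (label-∷ u v es v) (relabel-target _ (label es v))))
  label-complete {u} {v} {(s , t) ∷ es} (there uv∈es) =
    trans (label-∷ s t es u)
          (trans (cong (relabel _ _) (label-complete uv∈es)) (sym (label-∷ s t es v)))

  label-sound : ∀ {R : Rel (Fin n) 0ℓ} {es} → All (uncurry R) es →
                ∀ x y → label es x ≡ label es y → EqClosure R x y
  label-sound {R} [] x y eq
    rewrite Vec.lookup-allFin x | Vec.lookup-allFin y | eq = reflexive R
  label-sound {R} {(u , v) ∷ es} (uRv ∷ all) x y eq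
    rewrite label-∷ u v es x | label-∷ u v es y
    with label es x Fin.≟ label es u | label es y Fin.≟ label es u
  ... | yes x~u | yes y~u = label-sound all x y (trans x~u (sym y~u))
  ... | yes x~u | no  _   =
    transitive R (label-sound all x u x~u)
      (transitive R (return uRv) (label-sound all v y eq))
  ... | no  _   | yes y~u =
    transitive R (label-sound all x v eq)
      (transitive R (symmetric R (return uRv)) (label-sound all u y (sym y~u)))
  ... | no  _   | no  _   = label-sound all x y eq

  eqClosure? : ∀ {R : Rel (Fin n) 0ℓ} → Decidable R → Decidable (EqClosure R)
  eqClosure? {R} R? x y =
    map′ (label-sound (all-filter (uncurry R?) pairs) x y)
         (gfold isEquivalence (label edges) λ {u} {v} uRv →
            label-complete {u} {v}
              (∈-filter⁺ (uncurry R?) (∈-cartesianProduct⁺ (∈-allFin u) (∈-allFin v)) uRv))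
         (label edges x Fin.≟ label edges y)
    where
    pairs edges : List (Fin n × Fin n)
    pairs = cartesianProduct (allFin n) (allFin n)
    edges = filter (uncurry R?) pairs

-- (x , +) stands for the side x and (x , -) for the side x⁻.

Side : Set → Set
Side A = A × Sign

_⁻ : {A : Set} → Side A → Side A
(x , s) ⁻ = x , opposite s

Word : Set → Set
Word A = List (Side A)

next : ∀ {m} → Fin m → Fin m
next {suc m} i = suc (toℕ i) mod suc m

-- A word of length m labels the sides of an m-gon.  Its corners are Fin m, and
-- side i runs from corner i to corner next i.

module Genus {A : Set} (_≟_ : DecidableEquality A) where

  -- Side i is identified with side j, orientation reversed.  Only the start of
  -- side i and the end of side j are mentioned: exchanging i and j yields the
  -- identification of the two other endpoints.
  data Glued (w : Word A) : Rel (Fin (length w)) 0ℓ where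
    glue : ∀ i j → lookup w j ≡ lookup w i ⁻ → Glued w i (next j)

  glued? : ∀ w → Decidable (Glued w)
  glued? w u v =
    map′ (λ { (j , eq , refl) → glue u j eq })
         (λ { (glue _ j eq) → j , eq , refl })
         (Fin.any? λ j → (lookup w j ≟ₛ (lookup w u ⁻)) ×-dec (v Fin.≟ next j))
    where
    _≟ₛ_ : DecidableEquality (Side A)
    _≟ₛ_ = Product.≡-dec _≟_ Sign._≟_

  SameVertex : ∀ w → Rel (Fin (length w)) 0ℓ
  SameVertex w = EqClosure (Glued w)

  sameVertex? : ∀ w → Decidable (SameVertex w)
  sameVertex? w = eqClosure? (glued? w)

  numVertices : Word A → ℕ
  numVertices w = length (deduplicate (sameVertex? w) (allFin (length w)))

  -- Each edge of the surface comes from one side x and one side x⁻.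
  numEdges : Word A → ℕ
  numEdges w = length (filter (λ s → proj₂ s Sign.≟ Sign.+) w)

  -- The polygon is the only face.
  eulerCharacteristic : Word A → ℤ
  eulerCharacteristic w = + numVertices w ℤ.- + numEdges w ℤ.+ + 1

  -- Meaningful when each letter occurring in w occurs exactly once as x and
  -- exactly once as x⁻, so that the glued polygon is a closed orientable surface.
  HasGenus : ℕ → Word A → Set
  HasGenus g w = eulerCharacteristic w ≡ + 2 ℤ.- + (2 * g)

  hasGenus? : ∀ g w → Dec (HasGenus g w)
  hasGenus? g w = eulerCharacteristic w ℤ.≟ + 2 ℤ.- + (2 * g)

-- Fin n stands for the index set {1, …, n} in its usual order, so a[ k ] is the
-- letter with index toℕ k + 1.

data Letter (n : ℕ) : Set where
  a    : Letter n
  a[_] : Fin n → Letter n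

_≟ₗ_ : ∀ {n} → DecidableEquality (Letter n)
a      ≟ₗ a      = yes refl
a      ≟ₗ a[ _ ] = no λ ()
a[ _ ] ≟ₗ a      = no λ ()
a[ i ] ≟ₗ a[ j ] = map′ (cong a[_]) (λ { refl → refl }) (i Fin.≟ j)

module _ {n : ℕ} where

  R₁ R₂ R₃ R₄ : Subset n → Word (Letter n)
  R₁ K = map (λ k → a[ k ] , Sign.+) (filter (_∈? K) (reverse (allFin n)))
  R₂ K = map (λ k → a[ k ] , Sign.+) (filter (λ k → ¬? (k ∈? K)) (allFin n))
  R₃ T = map (λ t → a[ t ] , Sign.-) (filter (_∈? T) (reverse (allFin n)))
  R₄ T = map (λ t → a[ t ] , Sign.-) (filter (λ t → ¬? (t ∈? T)) (allFin n))

  ladder : Subset n → Subset n → Word (Letter n)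
  ladder K T = (a , Sign.+) ∷ R₁ K ++ R₂ K ++ (a , Sign.-) ∷ R₃ T ++ R₄ T

subsets : ∀ n → List (Subset n)
subsets zero    = Vec.[] ∷ []
subsets (suc n) = map (outside Vec.∷_) (subsets n) ++ map (inside Vec.∷_) (subsets n)

-- A list rather than a set: surfaces are counted with multiplicity.
𝒮₄ : ∀ n → List (Word (Letter n))
𝒮₄ n = cartesianProductWith ladder (subsets n) (subsets n)

genusCount : ℕ → ℕ → ℕ
genusCount n i = length (filter (hasGenus? i) (𝒮₄ n))
  where open Genus _≟ₗ_

IsMinGenus IsMaxGenus : ℕ → ℕ → Set
IsMinGenus n q = 0 < genusCount n q × (∀ i → 0 < genusCount n i → q ≤ i)
IsMaxGenus n r = 0 < genusCount n r × (∀ i → 0 < genusCount n i → i ≤ r)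

-- A finite sequence f q, …, f r is given by a function f on ℕ and its bounds.

LogConcave : (ℕ → ℕ) → ℕ → ℕ → Set
LogConcave f q r = ∀ i → q ≤ i → 2 + i ≤ r → f i * f (2 + i) ≤ f (1 + i) ^ 2

-- f q ≤ ⋯ ≤ f (l - 1) < f l = ⋯ = f m > f (m + 1) ≥ ⋯ ≥ f r
record UnimodalWithModes (f : ℕ → ℕ) (q r l m : ℕ) : Set where
  field
    q≤l        : q ≤ l
    l≤m        : l ≤ m
    m≤r        : m ≤ r
    ascending  : ∀ i → q ≤ i → suc i < l → f i ≤ f (suc i)
    rise       : ∀ i → q ≤ i → suc i ≡ l → f i < f l
    plateau    : ∀ i → l ≤ i → i < m → f i ≡ f (suc i)
    fall       : suc m ≤ r → f (suc m) < f m
    descending : ∀ i → suc m ≤ i → suc i ≤ r → f (suc i) ≤ f i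

{-# OPTIONS --safe #-}

-- Read from the outside in, a ladder word is obtained by placing each letter b
-- at one end of the block of positive sides and b⁻ at one end of the block of
-- negative sides.  Up to rotation the outermost letter either cancels (b b⁻) or
-- frames the rest as b X b⁻ Y; in a framed word b forms a handle with the next
-- letter, whatever the ends, and removing that handle leaves the word of the
-- remaining letters.  Writing E n and G n for the genus polynomials of the words
-- X Y and a X a⁻ Y on n letters, E (n + 1) = 2 G n + 2 E n and G (n + 1) = 4 x E n,
-- whose coefficients are powers of two times the Lucas triangle
-- C(i + d, i) + C(i + d - 1, i).  The ratio of consecutive coefficients is an
-- explicit decreasing function that crosses 1 at i = n / 3.

module Submission where

open import Defs
open import Algebra.Bundles using (AbelianGroup)
open import Data.Bool using (Bool; true; false; if_then_else_; not; _xor_)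
open import Data.Fin as Fin using (Fin; toℕ)
import Data.Fin.Properties as Fin
open import Data.Fin.Subset using (Subset)
open import Data.Fin.Subset.Properties using (_∈?_)
open import Data.Integer as ℤ using (+_)
import Data.Integer.Properties as ℤ
open import Data.Integer.Tactic.RingSolver using () renaming (solve-∀ to ℤ-solve-∀)
open import Data.List using (List; []; _∷_; [_]; _++_; allFin; cartesianProduct; cartesianProductWith; deduplicate; filter; length; lookup; map; reverse)
open import Data.List.Membership.Propositional using (_∈_)
open import Data.List.Membership.Propositional.Properties using (∈-++⁺ˡ; ∈-++⁺ʳ; ∈-++⁻; ∈-allFin; ∈-cartesianProduct⁺; ∈-filter⁺; ∈-lookup; ∈-map⁺; ∈-map⁻)
open import Data.List.Membership.Propositional.Properties.WithK using (unique∧set⇒bag)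
import Data.List.Properties as List
open import Data.List.Relation.Binary.BagAndSetEquality using (∼bag⇒↭)
open import Data.List.Relation.Binary.Permutation.Propositional.Properties using (↭-length)
open import Data.List.Relation.Unary.All as All using (All; []; _∷_)
import Data.List.Relation.Unary.All.Properties as All
open import Data.List.Relation.Unary.AllPairs as AllPairs using ([]; _∷_)
import Data.List.Relation.Unary.AllPairs.Properties as AllPairs
open import Data.List.Relation.Unary.Any as Any using (here; there)
import Data.List.Relation.Unary.Any.Properties as Any
import Data.List.Relation.Unary.Unique.DecSetoid.Properties as DecUnique
open import Data.List.Relation.Unary.Unique.Propositional using (Unique)
import Data.List.Relation.Unary.Unique.Propositional.Properties as Unique
open import Data.Maybe using (Maybe; just; nothing)
import Data.Maybe.Relation.Unary.All as Maybe
open import Data.Nat using (ℕ; zero; suc; _+_; _*_; _^_; _!; _≤_; _<_; z≤n; s≤s; NonZero; >-nonZero; ≢-nonZero)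
open import Data.Nat.DivMod using (_/_; _%_; m≡m%n+[m/n]*n; m/n*n≤m; m%n<n; m<n⇒m%n≡m; n%n≡0)
open import Data.Nat.ListAction using (sum)
import Data.Nat.ListAction.Properties as ListAction
import Data.Nat.Properties as ℕ
open import Data.Nat.Tactic.RingSolver using (solve-∀)
open import Data.Product using (_×_; _,_; proj₁; proj₂; ∃; ∃₂; map₁; uncurry)
import Data.Product.Properties as Product
open import Data.Sign using (Sign; opposite)
import Data.Sign as Sign
import Data.Sign.Properties as Sign
open import Data.Sum using (inj₁; inj₂)
open import Data.Unit using (⊤; tt)
import Data.Vec as Vec
import Data.Vec.Properties as Vec
open import Function using (_∘_; id; mk⇔; Injective)
open import Level using (0ℓ)
open import Relation.Binary using (Rel; DecidableEquality; DecSetoid; IsEquivalence)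
import Relation.Binary as Binary
open import Relation.Binary.Construct.Closure.Equivalence using (gfold; isEquivalence)
import Relation.Binary.PropositionalEquality as ≡
open import Relation.Binary.PropositionalEquality using (_≡_; _≢_; refl; sym; trans; cong; cong₂; subst; subst₂; module ≡-Reasoning)
open import Relation.Nullary using (Dec; does; yes; no; ¬?; contradiction)
open import Relation.Nullary.Decidable using (dec-true; dec-false; does-⇔)
open import Relation.Unary using (Pred; Decidable)

open import Algebra.Properties.Group (AbelianGroup.group ℤ.+-0-abelianGroup) using (∙-cancelˡ)

-- Vertices of a polygon with identified sides

-- The genus is defined through `numVertices`, which counts classes of positions in one fixed
-- polygon, and positions shift whenever a word is rotated or loses sides. Corners are therefore
-- named by the sides that start at them, and the number of vertices is pinned down by a universal
-- property; rotation and handle removal then become mere renamings of corners. Only ladders are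
-- compared with `numVertices`: the labels computed by the decision procedure are one particular
-- test labelling.
--
-- The recursion peels off the outermost letter, the one of largest index, whereas a `Subset` lists
-- the smallest index first. Hence the counting runs over reversed subsets.
--
-- The case n = 3 is exceptional because the ratio of consecutive coefficients equals 1 at a single
-- place, `i = d = 0`. Everywhere else it is strictly above or below 1.

⁻-involutive : ∀ {A : Set} (s : Side A) → (s ⁻) ⁻ ≡ s
⁻-involutive (x , Sign.+) = refl
⁻-involutive (x , Sign.-) = refl

-- A labelling f of sides gives the label of the corner at which each side starts;
-- b is the label of the corner at which the word ends.  Consistency says that f
-- respects the identification of the start of s⁻ with the end of s.

start : {A B : Set} → (Side A → B) → Word A → B → B
start f []      b = b
start f (s ∷ w) b = f s

Consistent : {A B : Set} → (Side A → B) → Word A → B → Set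
Consistent f []      b = ⊤
Consistent f (s ∷ w) b = f (s ⁻) ≡ start f w b × Consistent f w b

module _ {A B : Set} {f : Side A → B} where

  start-++ : ∀ u v b → start f (u ++ v) b ≡ start f u (start f v b)
  start-++ []      v b = refl
  start-++ (s ∷ u) v b = refl

  consistent-++⁻ : ∀ u v {b} → Consistent f (u ++ v) b →
                   Consistent f u (start f v b) × Consistent f v b
  consistent-++⁻ []      v cons        = tt , cons
  consistent-++⁻ (s ∷ u) v (eq , cons) =
    let consᵘ , consᵛ = consistent-++⁻ u v cons
    in (trans eq (start-++ u v _) , consᵘ) , consᵛ

  consistent-++⁺ : ∀ u v {b} → Consistent f u (start f v b) → Consistent f v b →
                   Consistent f (u ++ v) b
  consistent-++⁺ []      v _            consᵛ = consᵛ
  consistent-++⁺ (s ∷ u) v (eq , consᵘ) consᵛ =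
    trans eq (sym (start-++ u v _)) , consistent-++⁺ u v consᵘ consᵛ

  start-map : ∀ {C : Set} (h : B → C) w b → start (h ∘ f) w (h b) ≡ h (start f w b)
  start-map h []      b = refl
  start-map h (s ∷ w) b = refl

  consistent-map : ∀ {C : Set} (h : B → C) w {b} →
                   Consistent f w b → Consistent (h ∘ f) w (h b)
  consistent-map h []      _           = tt
  consistent-map h (s ∷ w) (eq , cons) =
    trans (cong h eq) (sym (start-map h w _)) , consistent-map h w cons

Agree : {A B : Set} → (f g : Side A → B) → Side A → Set
Agree f g s = f s ≡ g s × f (s ⁻) ≡ g (s ⁻)

module _ {A B : Set} {f g : Side A → B} where

  start-agree : ∀ {w} b → All (Agree f g) w → start f w b ≡ start g w b
  start-agree b []              = refl
  start-agree b ((eq , _) ∷ _)  = eq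

  consistent-agree : ∀ {w b} → All (Agree f g) w → Consistent g w b → Consistent f w b
  consistent-agree []                 _           = tt
  consistent-agree ((_ , eq⁻) ∷ all) (eq , cons) =
    trans eq⁻ (trans eq (sym (start-agree _ all))) , consistent-agree all cons

-- `just s` is the corner at which side s starts, and `nothing` the corner at
-- the end of the word.  The latter coincides with the first corner, but makes
-- the empty word a sphere with one vertex.

Labelling : Set → Set
Labelling B = Maybe (Side ℕ) → B

record Closed {B : Set} (F : Labelling B) (w : Word ℕ) : Set where
  constructor _,_
  field
    wraps      : start (F ∘ just) w (F nothing) ≡ F nothing
    consistent : Consistent (F ∘ just) w (F nothing)

open Closed

Corner : Word ℕ → Maybe (Side ℕ) → Set
Corner w = Maybe.All (_∈ w)

-- The vertices are the values of a labelling through which every other closed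
-- labelling factors; ℕ-valued test labellings suffice and avoid any mention of
-- equivalence closures.
record Vertices (w : Word ℕ) (k : ℕ) : Set where
  field
    vertex     : Labelling (Fin k)
    closed     : Closed vertex w
    surjective : ∀ v → ∃ λ c → Corner w c × vertex c ≡ v
    universal  : ∀ (F : Labelling ℕ) → Closed F w → ∀ {c d} → Corner w c → Corner w d →
                 vertex c ≡ vertex d → F c ≡ F d

-- The maps of corners are mutually inverse only up to identification, that is,
-- under every closed labelling.
record SameVertices (w w′ : Word ℕ) : Set₁ where
  field
    to          : Maybe (Side ℕ) → Maybe (Side ℕ)
    from        : Maybe (Side ℕ) → Maybe (Side ℕ)
    to-corner   : ∀ {c} → Corner w c → Corner w′ (to c)
    from-corner : ∀ {c} → Corner w′ c → Corner w (from c)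
    to-closed   : ∀ {B} {F : Labelling B} → Closed F w′ → Closed (F ∘ to) w
    from-closed : ∀ {B} {F : Labelling B} → Closed F w → Closed (F ∘ from) w′
    from∘to     : ∀ {B} {F : Labelling B} → Closed F w → ∀ {c} → Corner w c → F (from (to c)) ≡ F c
    to∘from     : ∀ {B} {F : Labelling B} → Closed F w′ → ∀ {c} → Corner w′ c → F (to (from c)) ≡ F c

-- Labellings are pulled back along `to` and `from`. Being inverse only under closed labellings is
-- enough, since both `vertex` and every test labelling `F` are closed.
vertices-transfer : ∀ {w w′ k} → SameVertices w w′ → Vertices w′ k → Vertices w k
vertices-transfer same V = record
  { vertex     = vertex ∘ to
  ; closed     = to-closed closed
  ; surjective = λ v → let c , c∈ , eq = surjective v in
                 from c , from-corner c∈ , trans (to∘from closed c∈) eq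
  ; universal  = λ F cl c∈ d∈ eq →
      trans (sym (from∘to cl c∈))
        (trans (universal (F ∘ from) (from-closed cl) (to-corner c∈) (to-corner d∈) eq)
               (from∘to cl d∈))
  }
  where open SameVertices same; open Vertices V

-- Rotation of a word

firstCorner : Word ℕ → Maybe (Side ℕ) → Maybe (Side ℕ)
firstCorner = start just

firstCorner-corner : ∀ u {w c} → (∀ {s} → s ∈ u → s ∈ w) → Corner w c → Corner w (firstCorner u c)
firstCorner-corner []      sub c∈ = c∈
firstCorner-corner (s ∷ u) sub c∈ = Maybe.just (sub (here refl))

-- `just` is the free labelling, in which each corner is its own label; every other value of `start`
-- is obtained from it by applying `F`.
firstCorner-label : ∀ {B : Set} (F : Labelling B) u c → F (firstCorner u c) ≡ start (F ∘ just) u (F c)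
firstCorner-label F u c = sym (start-map F u c)

vertices-[] : Vertices [] 1
vertices-[] = record
  { vertex     = λ _ → Fin.zero
  ; closed     = refl , tt
  ; surjective = λ { Fin.zero → nothing , Maybe.nothing , refl }
  ; universal  = λ { F cl Maybe.nothing Maybe.nothing _ → refl }
  }

-- Only the closing corner is renamed: the end of `u ++ v` is also its beginning, and in `v ++ u`
-- this is the corner where `u` starts, or again the closing corner if `u` is empty.
rotate : Word ℕ → Maybe (Side ℕ) → Maybe (Side ℕ)
rotate u nothing  = firstCorner u nothing
rotate u (just s) = just s

rotate-corner : ∀ u v {c} → Corner (u ++ v) c → Corner (v ++ u) (rotate u c)
rotate-corner u v Maybe.nothing   = firstCorner-corner u (∈-++⁺ʳ v) Maybe.nothing
rotate-corner u v (Maybe.just s∈) with ∈-++⁻ u s∈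
... | inj₁ s∈u = Maybe.just (∈-++⁺ʳ v s∈u)
... | inj₂ s∈v = Maybe.just (∈-++⁺ˡ s∈v)

rotate-closed : ∀ u v {B : Set} {F : Labelling B} → Closed F (v ++ u) → Closed (F ∘ rotate u) (u ++ v)
rotate-closed u v {F = F} (st , cons) =
  let consᵛ , consᵘ = consistent-++⁻ v u cons in
    trans (start-++ u v _) (trans (cong (start f u) wrap) (sym (firstCorner-label F u nothing)))
  , consistent-++⁺ u v (subst (Consistent f u) (sym wrap) consᵘ)
      (subst (Consistent f v) (sym (firstCorner-label F u nothing)) consᵛ)
  where
  f = F ∘ just
  wrap : start f v (F (firstCorner u nothing)) ≡ F nothing
  wrap = trans (cong (start f v) (firstCorner-label F u nothing)) (trans (sym (start-++ v u _)) st)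

rotate-inverse : ∀ u v {B : Set} {F : Labelling B} → Closed F (u ++ v) →
                 ∀ {c} → Corner (u ++ v) c → F (rotate v (rotate u c)) ≡ F c
rotate-inverse []      v {F = F} (st , _) Maybe.nothing = trans (firstCorner-label F v nothing) st
rotate-inverse (s ∷ u) v (st , _) Maybe.nothing = st
rotate-inverse u       v _        (Maybe.just _) = refl

vertices-rotate : ∀ u v {k} → Vertices (v ++ u) k → Vertices (u ++ v) k
vertices-rotate u v = vertices-transfer record
  { to          = rotate u
  ; from        = rotate v
  ; to-corner   = rotate-corner u v
  ; from-corner = rotate-corner v u
  ; to-closed   = rotate-closed u v
  ; from-closed = rotate-closed v u
  ; from∘to     = rotate-inverse u v
  ; to∘from     = rotate-inverse v u
  }

-- Removal of a cancelling pair and of a handle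

Distinct : Side ℕ → Side ℕ → Set
Distinct x s = proj₁ s ≢ proj₁ x

-- Kept opaque so that proofs see `update` only through the three laws below.
opaque
  update : {B : Set} → Side ℕ → B → B → (Side ℕ → B) → Side ℕ → B
  update (x , σ) b b⁻ f (y , τ) =
    if does (y ℕ.≟ x) then (if does (τ Sign.≟ σ) then b else b⁻) else f (y , τ)

module _ {B : Set} {b b⁻ : B} {f : Side ℕ → B} where opaque
  unfolding update

  update-at : ∀ x → update x b b⁻ f x ≡ b
  update-at (x , σ) rewrite dec-true (x ℕ.≟ x) refl | dec-true (σ Sign.≟ σ) refl = refl

  update-at⁻ : ∀ x → update x b b⁻ f (x ⁻) ≡ b⁻
  update-at⁻ (x , σ)
    rewrite dec-true (x ℕ.≟ x) refl | dec-false (opposite σ Sign.≟ σ) (Sign.s≢opposite[s] σ ∘ sym) = refl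

  update-other : ∀ x {s} → Distinct x s → update x b b⁻ f s ≡ f s
  update-other (x , σ) {y , τ} y≢x rewrite dec-false (y ℕ.≟ x) y≢x = refl

-- s⁻ starts at a new vertex, around which nothing but the cancelled pair lies.
vertices-cancel : ∀ s w {k} → All (Distinct s) w → Vertices w k → Vertices (s ∷ s ⁻ ∷ w) (suc k)
vertices-cancel s w {k} fresh V = record
  { vertex     = vertex′
  ; closed     = update-at s
               , refl
               , trans (cong (vertex′ ∘ just) (⁻-involutive s)) (trans (update-at s) (sym start′))
               , consistent-agree agree (consistent-map Fin.suc w (consistent closed))
  ; surjective = surjective′
  ; universal  = universal′
  }
  where
  open Vertices V
  vertex′ : Labelling (Fin (suc k))
  vertex′ nothing  = Fin.suc (vertex nothing)
  vertex′ (just t) = update s (Fin.suc (vertex nothing)) Fin.zero (Fin.suc ∘ vertex ∘ just) t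

  agree : All (Agree (vertex′ ∘ just) (Fin.suc ∘ vertex ∘ just)) w
  agree = All.map (λ {t} t≢s → update-other s t≢s , update-other s t≢s) fresh

  start′ : start (vertex′ ∘ just) w (Fin.suc (vertex nothing)) ≡ Fin.suc (vertex nothing)
  start′ = trans (start-agree _ agree)
                 (trans (start-map Fin.suc w _) (cong Fin.suc (wraps closed)))

  old : ∀ {c} → Corner w c → vertex′ c ≡ Fin.suc (vertex c)
  old Maybe.nothing     = refl
  old (Maybe.just t∈w) = update-other s (All.lookup fresh t∈w)

  grow : ∀ {c} → Corner w c → Corner (s ∷ s ⁻ ∷ w) c
  grow = Maybe.map (there ∘ there)

  surjective′ : ∀ v → ∃ λ c → Corner (s ∷ s ⁻ ∷ w) c × vertex′ c ≡ v
  surjective′ Fin.zero    = just (s ⁻) , Maybe.just (there (here refl)) , update-at⁻ s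
  surjective′ (Fin.suc v) = let c , c∈ , eq = surjective v in
    c , grow c∈ , trans (old c∈) (cong Fin.suc eq)

  -- A corner of the longer word is either the tip between `s` and `s ⁻` or is identified with a
  -- corner `d` of `w`. Recording both the vertex and the value of `F` reduces `universal′` to
  -- `universal`.
  data View {B : Set} (F : Labelling B) (c : Maybe (Side ℕ)) : Set where
    new      : vertex′ c ≡ Fin.zero → F c ≡ F (just (s ⁻)) → View F c
    retained : ∀ d → Corner w d → vertex′ c ≡ Fin.suc (vertex d) → F c ≡ F d → View F c

  view : ∀ {B : Set} (F : Labelling B) → Closed F (s ∷ s ⁻ ∷ w) → ∀ {c} → Corner (s ∷ s ⁻ ∷ w) c → View F c
  view F cl         Maybe.nothing                   = retained nothing Maybe.nothing refl refl
  view F (st , _)   (Maybe.just (here refl))          = retained nothing Maybe.nothing (update-at s) st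
  view F _          (Maybe.just (there (here refl)))  = new (update-at⁻ s) refl
  view F _          (Maybe.just (there (there t∈w))) = retained (just _) (Maybe.just t∈w) (old (Maybe.just t∈w)) refl

  shrink : ∀ {B : Set} {F : Labelling B} → Closed F (s ∷ s ⁻ ∷ w) → Closed F w
  shrink {F = F} (st , _ , eq , cons) =
    trans (sym eq) (trans (cong (F ∘ just) (⁻-involutive s)) st) , cons

  universal′ : ∀ (F : Labelling ℕ) → Closed F (s ∷ s ⁻ ∷ w) → ∀ {c d} →
               Corner (s ∷ s ⁻ ∷ w) c → Corner (s ∷ s ⁻ ∷ w) d → vertex′ c ≡ vertex′ d → F c ≡ F d
  universal′ F cl c∈ d∈ eq with view F cl c∈ | view F cl d∈
  ... | new _ Fc | new _ Fd = trans Fc (sym Fd)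
  ... | new v _  | retained _ _ v′ _ = contradiction (trans (sym v) (trans eq v′)) λ ()
  ... | retained _ _ v _ | new v′ _ = contradiction (trans (sym v′) (trans (sym eq) v)) λ ()
  ... | retained c′ c′∈ v Fc | retained d′ d′∈ v′ Fd =
    trans Fc (trans (universal F (shrink {F = F} cl) c′∈ d′∈ (suc-inj (trans (sym v) (trans eq v′)))) (sym Fd))
    where
    suc-inj : ∀ {n} {i j : Fin n} → Fin.suc i ≡ Fin.suc j → i ≡ j
    suc-inj refl = refl

-- The corners of a word x B y C x⁻ D y⁻ E match those of D C B E: the sides of
-- the handle start where the blocks D, E, B and C that follow their inverses do.
module _ (x y : Side ℕ) (B C D E : Word ℕ) (y≢x : Distinct x y)
         (x-fresh : All (Distinct x) (D ++ C ++ B ++ E))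
         (y-fresh : All (Distinct y) (D ++ C ++ B ++ E)) where

  private
    w w′ : Word ℕ
    w  = x ∷ B ++ y ∷ C ++ x ⁻ ∷ D ++ y ⁻ ∷ E
    w′ = D ++ C ++ B ++ E

    to : Maybe (Side ℕ) → Maybe (Side ℕ)
    to nothing  = nothing
    to (just s) =
      -- `D` opens `w′`, so the corner before it is the closing one. For the other blocks
      -- `firstCorner` skips to the next nonempty block.
      update x nothing (firstCorner (B ++ E) nothing)
        (update y (firstCorner E nothing) (firstCorner (C ++ B ++ E) nothing) just) s

    to-x : to (just x) ≡ nothing
    to-x = update-at x

    to-x⁻ : to (just (x ⁻)) ≡ firstCorner (B ++ E) nothing
    to-x⁻ = update-at⁻ x

    to-y : to (just y) ≡ firstCorner E nothing
    to-y = trans (update-other x y≢x) (update-at y)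

    to-y⁻ : to (just (y ⁻)) ≡ firstCorner (C ++ B ++ E) nothing
    to-y⁻ = trans (update-other x y≢x) (update-at⁻ y)

    to-old : ∀ {c} → Corner w′ c → to c ≡ c
    to-old Maybe.nothing   = refl
    to-old (Maybe.just s∈) =
      trans (update-other x (All.lookup x-fresh s∈)) (update-other y (All.lookup y-fresh s∈))

    ∈B : ∀ {s} → s ∈ B → s ∈ w′
    ∈B = ∈-++⁺ʳ D ∘ ∈-++⁺ʳ C ∘ ∈-++⁺ˡ
    ∈C : ∀ {s} → s ∈ C → s ∈ w′
    ∈C = ∈-++⁺ʳ D ∘ ∈-++⁺ˡ
    ∈D : ∀ {s} → s ∈ D → s ∈ w′
    ∈D = ∈-++⁺ˡ
    ∈E : ∀ {s} → s ∈ E → s ∈ w′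
    ∈E = ∈-++⁺ʳ D ∘ ∈-++⁺ʳ C ∘ ∈-++⁺ʳ B

    data Origin : Side ℕ → Set where
      is-x  : Origin x
      is-y  : Origin y
      is-x⁻ : Origin (x ⁻)
      is-y⁻ : Origin (y ⁻)
      is-old : ∀ {s} → s ∈ w′ → Origin s

    origin : ∀ {s} → s ∈ w → Origin s
    origin (here refl) = is-x
    origin (there s∈) with ∈-++⁻ B s∈
    ... | inj₁ s∈B = is-old (∈B s∈B)
    ... | inj₂ (here refl) = is-y
    ... | inj₂ (there s∈′) with ∈-++⁻ C s∈′
    ...   | inj₁ s∈C = is-old (∈C s∈C)
    ...   | inj₂ (here refl) = is-x⁻
    ...   | inj₂ (there s∈″) with ∈-++⁻ D s∈″
    ...     | inj₁ s∈D = is-old (∈D s∈D)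
    ...     | inj₂ (here refl) = is-y⁻
    ...     | inj₂ (there s∈E) = is-old (∈E s∈E)

    to-corner : ∀ {c} → Corner w c → Corner w′ (to c)
    to-corner Maybe.nothing = Maybe.nothing
    to-corner (Maybe.just s∈) with origin s∈
    ... | is-x = subst (Corner w′) (sym to-x) Maybe.nothing
    ... | is-y = subst (Corner w′) (sym to-y) (firstCorner-corner E ∈E Maybe.nothing)
    ... | is-x⁻ = subst (Corner w′) (sym to-x⁻)
                    (firstCorner-corner (B ++ E) (∈-++⁺ʳ D ∘ ∈-++⁺ʳ C) Maybe.nothing)
    ... | is-y⁻ = subst (Corner w′) (sym to-y⁻)
                    (firstCorner-corner (C ++ B ++ E) (∈-++⁺ʳ D) Maybe.nothing)
    ... | is-old s∈′ = subst (Corner w′) (sym (to-old (Maybe.just s∈′))) (Maybe.just s∈′)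

    from-corner : ∀ {c} → Corner w′ c → Corner w c
    from-corner Maybe.nothing = Maybe.nothing
    from-corner (Maybe.just s∈) with ∈-++⁻ D s∈
    ... | inj₁ s∈D = Maybe.just (there (∈-++⁺ʳ B (there (∈-++⁺ʳ C (there (∈-++⁺ˡ s∈D))))))
    ... | inj₂ s∈′ with ∈-++⁻ C s∈′
    ...   | inj₁ s∈C = Maybe.just (there (∈-++⁺ʳ B (there (∈-++⁺ˡ s∈C))))
    ...   | inj₂ s∈″ with ∈-++⁻ B s∈″
    ...     | inj₁ s∈B = Maybe.just (there (∈-++⁺ˡ s∈B))
    ...     | inj₂ s∈E = Maybe.just (there (∈-++⁺ʳ B (there (∈-++⁺ʳ C (there (∈-++⁺ʳ D (there s∈E)))))))

    module _ {X : Set} {F : Labelling X} where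

      to-closed : Closed F w′ → Closed (F ∘ to) w
      to-closed (st , cons)
        with consᴰ , cons′ ← consistent-++⁻ D (C ++ B ++ E) cons
        with consᶜ , cons″ ← consistent-++⁻ C (B ++ E) cons′
        with consᴮ , consᴱ ← consistent-++⁻ B E cons″
        = cong F to-x
        , Fto-x⁻
        , consistent-++⁺ B (y ∷ _) (subst (Consistent g B) (sym Fto-y) (consistent-agree agreeᴮ consᴮ))
            ( Fto-y⁻
            , consistent-++⁺ C (x ⁻ ∷ _) (subst (Consistent g C) (sym (trans (cong F to-x⁻) (firstCorner-label F (B ++ E) nothing))) (consistent-agree agreeᶜ consᶜ))
                ( Fto-x⁻⁻
                , consistent-++⁺ D (y ⁻ ∷ _) (subst (Consistent g D) (sym (trans (cong F to-y⁻) (firstCorner-label F (C ++ B ++ E) nothing))) (consistent-agree agreeᴰ consᴰ))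
                   ( trans (cong g (⁻-involutive y)) (trans Fto-y (sym (start-agree _ agreeᴱ)))
                   , consistent-agree agreeᴱ consᴱ)))
        where
        f g : Side ℕ → X
        f = F ∘ just
        g = F ∘ to ∘ just
        b : X
        b = F nothing
        agree : All (Agree g f) w′
        agree = All.tabulate λ {s} s∈ →
            cong F (to-old (Maybe.just s∈))
          , cong F (trans (update-other x {s ⁻} (All.lookup x-fresh s∈)) (update-other y (All.lookup y-fresh s∈)))
        agreeᴰ : All (Agree g f) D
        agreeᴰ = All.++⁻ˡ D agree
        agreeᶜ : All (Agree g f) C
        agreeᶜ = All.++⁻ˡ C (All.++⁻ʳ D agree)
        agreeᴮ : All (Agree g f) B
        agreeᴮ = All.++⁻ˡ B (All.++⁻ʳ C (All.++⁻ʳ D agree))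
        agreeᴱ : All (Agree g f) E
        agreeᴱ = All.++⁻ʳ B (All.++⁻ʳ C (All.++⁻ʳ D agree))
        Fto-y : g y ≡ start f E b
        Fto-y = trans (cong F to-y) (firstCorner-label F E nothing)
        Fto-x⁻ : g (x ⁻) ≡ start g (B ++ y ∷ C ++ x ⁻ ∷ D ++ y ⁻ ∷ E) b
        Fto-x⁻ = trans (cong F to-x⁻) (trans (firstCorner-label F (B ++ E) nothing)
                  (trans (start-++ B E b) (trans (sym (start-agree _ agreeᴮ))
                    (trans (cong (start g B) (sym Fto-y)) (sym (start-++ B _ b))))))
        Fto-y⁻ : g (y ⁻) ≡ start g (C ++ x ⁻ ∷ D ++ y ⁻ ∷ E) b
        Fto-y⁻ = trans (cong F to-y⁻) (trans (firstCorner-label F (C ++ B ++ E) nothing)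
                  (trans (start-++ C (B ++ E) b) (trans (sym (start-agree _ agreeᶜ))
                    (trans (cong (start g C) (sym (trans (cong F to-x⁻) (firstCorner-label F (B ++ E) nothing))))
                       (sym (start-++ C _ b))))))
        Fto-x⁻⁻ : g ((x ⁻) ⁻) ≡ start g (D ++ y ⁻ ∷ E) b
        Fto-x⁻⁻ = trans (cong g (⁻-involutive x)) (trans (cong F to-x)
                   (trans (sym st) (trans (start-++ D (C ++ B ++ E) b) (trans (sym (start-agree _ agreeᴰ))
                    (trans (cong (start g D) (sym (trans (cong F to-y⁻) (firstCorner-label F (C ++ B ++ E) nothing))))
                       (sym (start-++ D _ b)))))))

      module _ (cl : Closed F w) where
        private
          f = F ∘ just
          b = F nothing
          consᴮ = consistent-++⁻ B (y ∷ _) (proj₂ (consistent cl))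
          consᶜ = consistent-++⁻ C (x ⁻ ∷ _) (proj₂ (proj₂ consᴮ))
          consᴰ = consistent-++⁻ D (y ⁻ ∷ _) (proj₂ (proj₂ consᶜ))
          Fx : f x ≡ b
          Fx = wraps cl
          Fy : f y ≡ start f E b
          Fy = trans (cong f (sym (⁻-involutive y))) (proj₁ (proj₂ consᴰ))
          Fx⁻ : f (x ⁻) ≡ start f (B ++ E) b
          Fx⁻ = trans (proj₁ (consistent cl)) (trans (start-++ B _ b) (trans (cong (start f B) Fy) (sym (start-++ B E b))))
          Fy⁻ : f (y ⁻) ≡ start f (C ++ B ++ E) b
          Fy⁻ = trans (proj₁ (proj₂ consᴮ)) (trans (start-++ C _ b) (trans (cong (start f C) Fx⁻) (sym (start-++ C (B ++ E) b))))

        from-closed : Closed F w′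
        from-closed
          = trans (start-++ D _ b) (trans (cong (start f D) (sym Fy⁻)) (trans (sym (start-++ D (y ⁻ ∷ E) b))
              (trans (sym (proj₁ (proj₂ consᶜ))) (trans (cong f (⁻-involutive x)) Fx))))
          , consistent-++⁺ D _ (subst (Consistent f D) Fy⁻ (proj₁ consᴰ))
              (consistent-++⁺ C _ (subst (Consistent f C) Fx⁻ (proj₁ consᶜ))
                (consistent-++⁺ B E (subst (Consistent f B) Fy (proj₁ consᴮ)) (proj₂ (proj₂ consᴰ))))

        from∘to : ∀ {c} → Corner w c → F (to c) ≡ F c
        from∘to Maybe.nothing = refl
        from∘to (Maybe.just s∈) with origin s∈
        ... | is-x  = trans (cong F to-x) (sym Fx)
        ... | is-y  = trans (cong F to-y) (trans (firstCorner-label F E nothing) (sym Fy))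
        ... | is-x⁻ = trans (cong F to-x⁻) (trans (firstCorner-label F (B ++ E) nothing) (sym Fx⁻))
        ... | is-y⁻ = trans (cong F to-y⁻) (trans (firstCorner-label F (C ++ B ++ E) nothing) (sym Fy⁻))
        ... | is-old s∈′ = cong F (to-old (Maybe.just s∈′))

  vertices-handle : ∀ {k} → Vertices w′ k → Vertices w k
  vertices-handle = vertices-transfer record
    { to          = to
    ; from        = id
    ; to-corner   = to-corner
    ; from-corner = from-corner
    ; to-closed   = λ {_} {F} → to-closed {F = F}
    ; from-closed = λ {_} {F} → from-closed {F = F}
    ; from∘to     = λ {_} {F} → from∘to {F = F}
    ; to∘from     = λ {_} {F} _ c∈ → cong F (to-old c∈)
    }

-- Vertices of ladder words

insert : {A : Set} → Bool → A → List A → List A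
insert b x xs = if b then x ∷ xs else xs ++ [ x ]

-- The head of the subset concerns the outermost letter.
arrange : Sign → ∀ {n} → Subset n → Word ℕ
arrange σ Vec.[]                = []
arrange σ {suc n} (b Vec.∷ K) = insert b (n , σ) (arrange σ K)

word : ∀ {n} → Subset n → Subset n → Word ℕ
word K T = arrange Sign.+ K ++ arrange Sign.- T

mutual
  wordGenus : ∀ {n} → Subset n → Subset n → ℕ
  wordGenus Vec.[]      Vec.[]      = 0
  wordGenus (k Vec.∷ K) (t Vec.∷ T) = if k xor t then wordGenus K T else framedGenus K T

  framedGenus : ∀ {n} → Subset n → Subset n → ℕ
  framedGenus Vec.[]      Vec.[]      = 0
  framedGenus (_ Vec.∷ K) (_ Vec.∷ T) = suc (wordGenus K T)

insert-all : ∀ {A : Set} {P : A → Set} b {x xs} → P x → All P xs → All P (insert b x xs)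
insert-all true  px pxs = px ∷ pxs
insert-all false px pxs = All.++⁺ pxs (px ∷ [])

arrange-< : ∀ σ {n} (K : Subset n) → All (λ s → proj₁ s < n) (arrange σ K)
arrange-< σ Vec.[]      = []
arrange-< σ (b Vec.∷ K) = insert-all b (ℕ.n<1+n _) (All.map ℕ.m<n⇒m<1+n (arrange-< σ K))

arrange-distinct : ∀ σ {n} (K : Subset n) s → n ≤ proj₁ s → All (Distinct s) (arrange σ K)
arrange-distinct σ K s n≤s = All.map (λ t<n → ℕ.<⇒≢ (ℕ.<-≤-trans t<n n≤s)) (arrange-< σ K)

-- Euler's relation V - E + 1 = 2 - 2g for a single face, with `e` edges and cleared of subtraction.
record HasVertices (w : Word ℕ) (g e : ℕ) : Set where
  constructor hasVertices
  field
    count    : ℕ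
    vertices : Vertices w count
    euler    : count + 2 * g ≡ suc e


hasVertices-cancel : ∀ {w w′ g e} → (∀ {k} → Vertices w k → Vertices w′ (suc k)) → HasVertices w g e → HasVertices w′ g (suc e)
hasVertices-cancel f (hasVertices k V eq) = hasVertices (suc k) (f V) (cong suc eq)

hasVertices-handle : ∀ {w w′ g e} → (∀ {k} → Vertices w k → Vertices w′ k) → HasVertices w g e → HasVertices w′ (suc g) (2 + e)
hasVertices-handle {g = g} f (hasVertices k V eq) = hasVertices k (f V)
  (trans (cong (λ m → k + m) (ℕ.*-suc 2 g))
    (trans (ℕ.+-suc k _) (cong suc (trans (ℕ.+-suc k _) (cong suc eq)))))

hasVertices-map : ∀ {w w′ g e} → (∀ {k} → Vertices w k → Vertices w′ k) → HasVertices w g e → HasVertices w′ g e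
hasVertices-map f (hasVertices k V eq) = hasVertices k (f V) eq

mutual
  word-vertices : ∀ {n} (K T : Subset n) → HasVertices (word K T) (wordGenus K T) n
  word-vertices Vec.[] Vec.[] = hasVertices 1 vertices-[] refl
  word-vertices (true  Vec.∷ K) (true  Vec.∷ T) = framed-vertices _ ℕ.≤-refl K T
  -- `X b Y b⁻` is cyclically `b⁻ X b Y`, a word framed by the negative side `b⁻`.
  word-vertices {suc n} (false Vec.∷ K) (false Vec.∷ T) =
    hasVertices-map (λ {k} V → subst (λ w → Vertices w k) regroup (vertices-rotate (X ++ b ∷ Y) [ b ⁻ ] V))
      (framed-vertices (b ⁻) ℕ.≤-refl K T)
    where
    b = n , Sign.+
    X = arrange Sign.+ K
    Y = arrange Sign.- T
    regroup : (X ++ b ∷ Y) ++ [ b ⁻ ] ≡ (X ++ [ b ]) ++ Y ++ [ b ⁻ ]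
    regroup = trans (List.++-assoc X (b ∷ Y) [ b ⁻ ]) (sym (List.++-assoc X [ b ] (Y ++ [ b ⁻ ])))
  -- In `b X Y b⁻` the two sides meet across the end of the word, so rotation yields the pair
  -- `b⁻ b`.
  word-vertices {suc n} (true  Vec.∷ K) (false Vec.∷ T) =
    hasVertices-cancel (λ {k} V → subst (λ w → Vertices w (suc k)) (List.++-assoc (b ∷ X) Y [ b ⁻ ])
        (vertices-rotate (b ∷ X ++ Y) [ b ⁻ ] (vertices-cancel (b ⁻) _ fresh V)))
      (word-vertices K T)
    where
    b = n , Sign.+
    X = arrange Sign.+ K
    Y = arrange Sign.- T
    fresh : All (Distinct (b ⁻)) (X ++ Y)
    fresh = All.++⁺ (arrange-distinct Sign.+ K (b ⁻) ℕ.≤-refl) (arrange-distinct Sign.- T (b ⁻) ℕ.≤-refl)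
  word-vertices {suc n} (false Vec.∷ K) (true  Vec.∷ T) =
    hasVertices-cancel (λ {k} V → subst (λ w → Vertices w (suc k)) (sym (List.++-assoc X [ b ] (b ⁻ ∷ Y)))
        (vertices-rotate X (b ∷ b ⁻ ∷ Y) (vertices-cancel b _ fresh (vertices-rotate Y X V))))
      (word-vertices K T)
    where
    b = n , Sign.+
    X = arrange Sign.+ K
    Y = arrange Sign.- T
    fresh : All (Distinct b) (Y ++ X)
    fresh = All.++⁺ (arrange-distinct Sign.- T b ℕ.≤-refl) (arrange-distinct Sign.+ K b ℕ.≤-refl)

  -- The frame is any side, of either sign, whose letter lies above those of `K` and `T`. This
  -- covers both framed cases of `word-vertices` and the frame `a` of a ladder.
  framed-vertices : ∀ {n} s → n ≤ proj₁ s → (K T : Subset n) →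
    HasVertices (s ∷ arrange Sign.+ K ++ s ⁻ ∷ arrange Sign.- T) (framedGenus K T) (suc n)
  framed-vertices s _ Vec.[] Vec.[] = hasVertices 2 (vertices-cancel s [] [] vertices-[]) refl
  framed-vertices {suc n} s n<s (k Vec.∷ K) (t Vec.∷ T) = hasVertices-handle (λ {v} → step k t {v}) (word-vertices K T)
    where
    c = n , Sign.+
    X = arrange Sign.+ K
    Y = arrange Sign.- T
    c≢s : Distinct s c
    c≢s = ℕ.<⇒≢ n<s
    fresh : ∀ x → n ≤ proj₁ x → All (Distinct x) (X ++ Y)
    fresh x n≤x = All.++⁺ (arrange-distinct Sign.+ K x n≤x) (arrange-distinct Sign.- T x n≤x)
    fresh′ : ∀ x → n ≤ proj₁ x → All (Distinct x) (Y ++ X ++ [])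
    fresh′ x n≤x = All.++⁺ (arrange-distinct Sign.- T x n≤x) (All.++⁺ (arrange-distinct Sign.+ K x n≤x) [])
    swapped : ∀ {v} → Vertices (X ++ Y) v → Vertices (Y ++ X ++ []) v
    swapped {v} V = subst (λ X′ → Vertices (Y ++ X′) v) (sym (List.++-identityʳ X)) (vertices-rotate Y X V)
    step : ∀ k t {v} → Vertices (X ++ Y) v → Vertices (s ∷ insert k c X ++ s ⁻ ∷ insert t (c ⁻) Y) v
    -- The choice of ends makes two of the four blocks around the handle empty. The reordered word
    -- `D C B E` is then `X Y` or `Y X`, which are rotations of each other.
    step true  true  V = vertices-handle s c [] X [] Y c≢s (fresh s (ℕ.<⇒≤ n<s)) (fresh c ℕ.≤-refl) V
    step true  false V = vertices-handle s c [] X Y [] c≢s (fresh′ s (ℕ.<⇒≤ n<s)) (fresh′ c ℕ.≤-refl) (swapped V)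
    step false true  {v} V = subst (λ w → Vertices (s ∷ w) v) (sym (List.++-assoc X [ c ] _))
      (vertices-handle s c X [] [] Y c≢s (fresh s (ℕ.<⇒≤ n<s)) (fresh c ℕ.≤-refl) V)
    step false false {v} V = subst (λ w → Vertices (s ∷ w) v) (sym (List.++-assoc X [ c ] _))
      (vertices-handle s c X [] Y [] c≢s (fresh′ s (ℕ.<⇒≤ n<s)) (fresh′ c ℕ.≤-refl) (swapped V))

-- Agreement with numVertices

length-enumeration : ∀ {n} (xs : List (Fin n)) → Unique xs → (∀ i → i ∈ xs) → length xs ≡ n
length-enumeration xs xs! i∈xs =
  trans (↭-length (∼bag⇒↭ (unique∧set⇒bag xs! (Unique.allFin⁺ _) (mk⇔ (λ _ → ∈-allFin _) (λ _ → i∈xs _)))))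
        (List.length-tabulate (λ i → i))

module _ {A : Set} {_≈_ : Rel A 0ℓ} (≈-equiv : IsEquivalence _≈_) (_≈?_ : Binary.Decidable _≈_)
         {k : ℕ} (f : A → Fin k) (f-cong : ∀ {x y} → x ≈ y → f x ≡ f y)
         (f-injective : ∀ {x y} → f x ≡ f y → x ≈ y) where

  -- The representatives kept by `deduplicate` are pairwise inequivalent and meet every class, so
  -- `f` maps them to an enumeration of `Fin k` without repetition.
  length-classes : ∀ xs → (∀ v → ∃ λ x → x ∈ xs × f x ≡ v) → length (deduplicate _≈?_ xs) ≡ k
  length-classes xs surj = trans (sym (List.length-map f ys)) (length-enumeration (map f ys) fys! v∈fys)
    where
    ys : List A
    ys = deduplicate _≈?_ xs
    setoid : DecSetoid 0ℓ 0ℓ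
    setoid = record { isDecEquivalence = record { isEquivalence = ≈-equiv ; _≟_ = _≈?_ } }
    fys! : Unique (map f ys)
    fys! = AllPairs.map⁺ (AllPairs.map (λ x≉y fx≡fy → x≉y (f-injective fx≡fy)) (DecUnique.deduplicate-! setoid xs))
    v∈fys : ∀ v → v ∈ map f ys
    v∈fys v with x , x∈xs , refl ← surj v =
      Any.map⁺ (Any.deduplicate⁺ _≈?_ {P = λ y → f x ≡ f y} (λ y≈z fx≡fy → trans fx≡fy (sym (f-cong y≈z)))
        (Any.map (cong f) x∈xs))

toℕ-next : ∀ {m} (j : Fin (suc m)) → toℕ (next j) ≡ suc (toℕ j) % suc m
toℕ-next {m} j = Fin.toℕ-fromℕ< (m%n<n (suc (toℕ j)) (suc m))

module _ {A B : Set} (f : Side A → B) where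

  -- The label of the corner at which side `j` ends: the start of the next side, or `b` after the
  -- last one. It restates `Consistent` by positions.
  follow : ∀ (w : Word A) → B → Fin (length w) → B
  follow (s ∷ w) b Fin.zero    = start f w b
  follow (s ∷ w) b (Fin.suc j) = follow w b j

  consistent-follow⁺ : ∀ (w : Word A) {b} → (∀ j → f (lookup w j ⁻) ≡ follow w b j) → Consistent f w b
  consistent-follow⁺ []      eq = tt
  consistent-follow⁺ (s ∷ w) eq = eq Fin.zero , consistent-follow⁺ w (eq ∘ Fin.suc)

  consistent-follow⁻ : ∀ (w : Word A) {b} → Consistent f w b → ∀ j → f (lookup w j ⁻) ≡ follow w b j
  consistent-follow⁻ (s ∷ w) (eq , cons) Fin.zero    = eq
  consistent-follow⁻ (s ∷ w) (eq , cons) (Fin.suc j) = consistent-follow⁻ w cons j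

  follow-inner : ∀ (w : Word A) b (i j : Fin (length w)) → toℕ i ≡ suc (toℕ j) → follow w b j ≡ f (lookup w i)
  follow-inner (s ∷ t ∷ w) b (Fin.suc Fin.zero) Fin.zero eq = refl
  follow-inner (s ∷ w) b (Fin.suc i) (Fin.suc j) eq = follow-inner w b i j (ℕ.suc-injective eq)

  follow-last : ∀ (w : Word A) b (j : Fin (length w)) → suc (toℕ j) ≡ length w → follow w b j ≡ b
  follow-last (s ∷ [])    b Fin.zero    eq = refl
  follow-last (s ∷ w)     b (Fin.suc j) eq = follow-last w b j (ℕ.suc-injective eq)

  -- Once the closing label is that of the first side, the linear successor agrees with the cyclic
  -- `next`.
  follow-next : ∀ s w j → follow (s ∷ w) (f s) j ≡ f (lookup (s ∷ w) (next j))
  follow-next s w j with ℕ.m≤n⇒m<n∨m≡n (Fin.toℕ<n j)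
  ... | inj₁ inner = follow-inner (s ∷ w) (f s) (next j) j (trans (toℕ-next j) (m<n⇒m%n≡m inner))
  ... | inj₂ last  = trans (follow-last (s ∷ w) (f s) j last) (cong (f ∘ lookup (s ∷ w)) (sym next≡0))
    where
    next≡0 : next j ≡ Fin.zero
    next≡0 = Fin.toℕ-injective (trans (toℕ-next j) (trans (cong (_% suc (length w)) last) (n%n≡0 (suc (length w)))))

module _ {A A′ B : Set} (φ : A → A′) (f : Side A′ → B) where

  start-relabel : ∀ (w : Word A) b → start f (map (map₁ φ) w) b ≡ start (f ∘ map₁ φ) w b
  start-relabel []      b = refl
  start-relabel (s ∷ w) b = refl

  consistent-relabel⁺ : ∀ (w : Word A) {b} → Consistent (f ∘ map₁ φ) w b → Consistent f (map (map₁ φ) w) b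
  consistent-relabel⁺ []      cons        = tt
  consistent-relabel⁺ (s ∷ w) (eq , cons) = trans eq (sym (start-relabel w _)) , consistent-relabel⁺ w cons

  consistent-relabel⁻ : ∀ (w : Word A) {b} → Consistent f (map (map₁ φ) w) b → Consistent (f ∘ map₁ φ) w b
  consistent-relabel⁻ []      cons        = tt
  consistent-relabel⁻ (s ∷ w) (eq , cons) = trans eq (start-relabel w _) , consistent-relabel⁻ w cons

lookup-unique : ∀ {A B : Set} (f : A → B) xs → Unique (map f xs) →
                ∀ i j → f (lookup xs i) ≡ f (lookup xs j) → i ≡ j
lookup-unique f (x ∷ xs) _           Fin.zero    Fin.zero    eq = refl
lookup-unique f (x ∷ xs) (x∉xs ∷ _) Fin.zero    (Fin.suc j) eq =
  contradiction eq (All.lookup (All.map⁻ x∉xs) (∈-lookup j))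
lookup-unique f (x ∷ xs) (x∉xs ∷ _) (Fin.suc i) Fin.zero    eq =
  contradiction (sym eq) (All.lookup (All.map⁻ x∉xs) (∈-lookup i))
lookup-unique f (x ∷ xs) (_ ∷ xs!)  (Fin.suc i) (Fin.suc j) eq = cong Fin.suc (lookup-unique f xs xs! i j eq)

module _ {A : Set} (_≟_ : DecidableEquality A) where
  open Genus _≟_

  module _ (w : Word A) where

    private
      gluedPairs : List (Fin (length w) × Fin (length w))
      gluedPairs = filter (uncurry (glued? w)) (cartesianProduct (allFin _) (allFin _))

    -- The labels of the decision procedure for `SameVertex`, as natural numbers so that they can
    -- feed the test labellings of `Vertices`.
    vertexLabel : Fin (length w) → ℕ
    vertexLabel i = toℕ (label gluedPairs i)

    vertexLabel-glued : ∀ {i j} → Glued w i j → vertexLabel i ≡ vertexLabel j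
    vertexLabel-glued {i} {j} g = cong toℕ (label-complete {u = i} {v = j}
      (∈-filter⁺ (uncurry (glued? w)) (∈-cartesianProduct⁺ (∈-allFin i) (∈-allFin j)) g))

    vertexLabel-sound : ∀ i j → vertexLabel i ≡ vertexLabel j → SameVertex w i j
    vertexLabel-sound i j eq =
      label-sound (All.all-filter (uncurry (glued? w)) (cartesianProduct (allFin _) (allFin _))) i j (Fin.toℕ-injective eq)

  module _ (φ : A → ℕ) (φ-injective : Injective _≡_ _≡_ φ) (s₀ : Side A) (w₀ : Word A) where

    private
      w : Word A
      w = s₀ ∷ w₀
      W : Word ℕ
      W = map (map₁ φ) w

      ψ : Side A → Side ℕ
      ψ = map₁ φ

      ψ-injective : ∀ {s t} → ψ s ≡ ψ t → s ≡ t
      ψ-injective {x , σ} {y , τ} eq with refl ← φ-injective (cong proj₁ eq) = cong (x ,_) (cong proj₂ eq)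

    module _ {k : ℕ} (V : Vertices W k) (W! : Unique W) (W⁻ : ∀ {s} → s ∈ W → s ⁻ ∈ W) where
      open Vertices V

      private
        c : Fin (length w) → Fin k
        c i = vertex (just (ψ (lookup w i)))

        locate : ∀ {s} → s ∈ W → ∃ λ i → ψ (lookup w i) ≡ s
        locate s∈W with t , t∈w , refl ← ∈-map⁻ ψ s∈W = Any.index t∈w , cong ψ (sym (Any.lookup-index t∈w))

        inverse : ∀ j → ∃ λ i → lookup w i ≡ lookup w j ⁻
        inverse j = let i , eq = locate (W⁻ (∈-map⁺ ψ (∈-lookup j))) in i , ψ-injective eq

        -- `vertexLabel` indexed by sides instead of positions. The closing corner takes the label
        -- of corner zero, which exists since the word is nonempty; sides outside `W` get the
        -- default 0, which no position has.
        F : Labelling ℕ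
        F nothing  = suc (vertexLabel w Fin.zero)
        F (just s) with Any.any? (λ t → Product.≡-dec ℕ._≟_ Sign._≟_ (ψ t) s) w
        ... | yes t∈w = suc (vertexLabel w (Any.index t∈w))
        ... | no  _   = 0

        F-lookup : ∀ i → F (just (ψ (lookup w i))) ≡ suc (vertexLabel w i)
        F-lookup i with Any.any? (λ t → Product.≡-dec ℕ._≟_ Sign._≟_ (ψ t) (ψ (lookup w i))) w
        ... | yes t∈w = cong (suc ∘ vertexLabel w) (lookup-unique ψ w W! _ i (Any.lookup-index t∈w))
        ... | no  t∉w = contradiction (Any.map (λ eq → cong ψ (sym eq)) (∈-lookup {xs = w} i)) t∉w

        F-closed : Closed F W
        F-closed = F-lookup Fin.zero ,
          consistent-relabel⁺ φ f w (subst (Consistent (f ∘ ψ) w) (F-lookup Fin.zero)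
            (consistent-follow⁺ (f ∘ ψ) w λ j → trans (step j) (sym (follow-next (f ∘ ψ) s₀ w₀ j))))
          where
          f : Side ℕ → ℕ
          f = F ∘ just
          step : ∀ j → f (ψ (lookup w j ⁻)) ≡ f (ψ (lookup w (next j)))
          step j with i , eq ← inverse j =
            trans (cong (f ∘ ψ) (sym eq)) (trans (F-lookup i)
              (trans (cong suc (vertexLabel-glued w (glue i j (trans (sym (⁻-involutive _)) (cong _⁻ (sym eq))))))
                (sym (F-lookup (next j)))))

        c-glued : ∀ {i j} → Glued w i j → c i ≡ c j
        c-glued (glue i j eq) =
          trans (cong (f ∘ ψ) (trans (sym (⁻-involutive _)) (cong _⁻ (sym eq))))
            (trans (consistent-follow⁻ (f ∘ ψ) w cons j) (follow-next (f ∘ ψ) s₀ w₀ j))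
          where
          f : Side ℕ → Fin k
          f = vertex ∘ just
          cons : Consistent (f ∘ ψ) w (f (ψ s₀))
          cons = subst (Consistent (f ∘ ψ) w) (sym (Closed.wraps closed)) (consistent-relabel⁻ φ f w (Closed.consistent closed))

        c-injective : ∀ {i j} → c i ≡ c j → SameVertex w i j
        c-injective {i} {j} eq = vertexLabel-sound w i j (ℕ.suc-injective
          (trans (sym (F-lookup i)) (trans (universal F F-closed (corner i) (corner j) eq) (F-lookup j))))
          where
          corner : ∀ i → Corner W (just (ψ (lookup w i)))
          corner i = Maybe.just (∈-map⁺ ψ (∈-lookup i))

        c-surjective : ∀ v → ∃ λ i → i ∈ allFin (length w) × c i ≡ v
        c-surjective v with surjective v
        ... | nothing , Maybe.nothing  , eq = Fin.zero , ∈-allFin _ , trans (Closed.wraps closed) eq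
        ... | just s  , Maybe.just s∈W , eq with i , refl ← locate s∈W = i , ∈-allFin i , eq

      -- Glued corners have equal vertices because `vertex` is closed. Conversely, `universal`
      -- applied to the decision procedure's own labelling `F` shows that corners with equal
      -- vertices are related by `SameVertex`.
      numVertices-vertices : numVertices w ≡ k
      numVertices-vertices =
        length-classes (isEquivalence (Glued w)) (sameVertex? w) c
          (gfold ≡.isEquivalence c c-glued) c-injective (allFin _) c-surjective

-- The genus of a ladder

filter-map : ∀ {A B : Set} {P : Pred A 0ℓ} {Q : Pred B 0ℓ} (P? : Decidable P) (Q? : Decidable Q) (f : A → B) →
             (∀ x → does (Q? (f x)) ≡ does (P? x)) → ∀ xs → filter Q? (map f xs) ≡ map f (filter P? xs)
filter-map P? Q? f eq [] = refl
filter-map P? Q? f eq (x ∷ xs) rewrite eq x with does (P? x)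
... | true  = cong (f x ∷_) (filter-map P? Q? f eq xs)
... | false = filter-map P? Q? f eq xs

select : {A : Set} → Bool → A → List A
select b x = if b then [ x ] else []

-- The decreasing and the increasing half of a block, by recursion on the innermost letter, whose
-- number is `o`. The lemmas for `∷ʳ` convert this to the recursion of `arrange` on the outermost
-- letter.
down up : Sign → ℕ → ∀ {n} → Subset n → Word ℕ
down σ o Vec.[]      = []
down σ o (b Vec.∷ K) = down σ (suc o) K ++ select b (o , σ)
up σ o Vec.[]      = []
up σ o (b Vec.∷ K) = select (not b) (o , σ) ++ up σ (suc o) K

allFin-suc : ∀ n → allFin (suc n) ≡ Fin.zero ∷ map Fin.suc (allFin n)
allFin-suc n = cong (Fin.zero ∷_) (sym (List.map-tabulate id Fin.suc))

module _ (σ : Sign) where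
  open ≡-Reasoning

  private
    side : ∀ o {n} → Fin n → Side ℕ
    side o k = o + toℕ k , σ

    side-suc : ∀ o {n} (k : Fin n) → side o (Fin.suc k) ≡ side (suc o) k
    side-suc o k = cong (_, σ) (ℕ.+-suc o (toℕ k))

    sides-suc : ∀ o {n} (ks : List (Fin n)) → map (side o) (map Fin.suc ks) ≡ map (side (suc o)) ks
    sides-suc o ks = trans (sym (List.map-∘ ks)) (List.map-cong (side-suc o) ks)

    head-∈ : ∀ o b {n} (K : Subset n) →
             map (side o) (filter (_∈? (b Vec.∷ K)) [ Fin.zero ]) ≡ select b (o , σ)
    head-∈ o true  K = cong (λ m → [ m , σ ]) (ℕ.+-identityʳ o)
    head-∈ o false K = refl

    head-∉ : ∀ o b {n} (K : Subset n) →
             map (side o) (filter (λ k → ¬? (k ∈? (b Vec.∷ K))) [ Fin.zero ]) ≡ select (not b) (o , σ)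
    head-∉ o true  K = refl
    head-∉ o false K = cong (λ m → [ m , σ ]) (ℕ.+-identityʳ o)

  filter-down : ∀ o {n} (K : Subset n) →
                map (side o) (filter (_∈? K) (reverse (allFin n))) ≡ down σ o K
  filter-down o Vec.[] = refl
  filter-down o {suc n} (b Vec.∷ K) = begin
    map (side o) (filter P? (reverse (allFin (suc n))))
      ≡⟨ cong (map (side o) ∘ filter P? ∘ reverse) (allFin-suc n) ⟩
    map (side o) (filter P? (reverse (Fin.zero ∷ map Fin.suc (allFin n))))
      ≡⟨ cong (map (side o) ∘ filter P?) (trans (List.unfold-reverse Fin.zero (map Fin.suc (allFin n)))
           (cong (_++ [ Fin.zero ]) (sym (List.reverse-map Fin.suc (allFin n))))) ⟩
    map (side o) (filter P? (map Fin.suc ks ++ [ Fin.zero ]))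
      ≡⟨ cong (map (side o)) (List.filter-++ P? (map Fin.suc ks) [ Fin.zero ]) ⟩
    map (side o) (filter P? (map Fin.suc ks) ++ filter P? [ Fin.zero ])
      ≡⟨ List.map-++ (side o) (filter P? (map Fin.suc ks)) _ ⟩
    map (side o) (filter P? (map Fin.suc ks)) ++ map (side o) (filter P? [ Fin.zero ])
      ≡⟨ cong₂ _++_ (trans (cong (map (side o)) (filter-map (_∈? K) P? Fin.suc (λ _ → refl) ks))
           (trans (sides-suc o _) (filter-down (suc o) K))) (head-∈ o b K) ⟩
    down σ (suc o) K ++ select b (o , σ) ∎
    where
    P? = _∈? (b Vec.∷ K)
    ks = reverse (allFin n)

  filter-up : ∀ o {n} (K : Subset n) →
              map (side o) (filter (λ k → ¬? (k ∈? K)) (allFin n)) ≡ up σ o K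
  filter-up o Vec.[] = refl
  filter-up o {suc n} (b Vec.∷ K) = begin
    map (side o) (filter P? (allFin (suc n)))
      ≡⟨ cong (map (side o) ∘ filter P?) (allFin-suc n) ⟩
    map (side o) (filter P? ([ Fin.zero ] ++ map Fin.suc (allFin n)))
      ≡⟨ cong (map (side o)) (List.filter-++ P? [ Fin.zero ] (map Fin.suc (allFin n))) ⟩
    map (side o) (filter P? [ Fin.zero ] ++ filter P? (map Fin.suc (allFin n)))
      ≡⟨ List.map-++ (side o) (filter P? [ Fin.zero ]) _ ⟩
    map (side o) (filter P? [ Fin.zero ]) ++ map (side o) (filter P? (map Fin.suc (allFin n)))
      ≡⟨ cong₂ _++_ (head-∉ o b K)
           (trans (cong (map (side o)) (filter-map (λ k → ¬? (k ∈? K)) P? Fin.suc (λ _ → refl) (allFin n)))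
             (trans (sides-suc o _) (filter-up (suc o) K))) ⟩
    select (not b) (o , σ) ++ up σ (suc o) K ∎
    where
    P? = λ k → ¬? (k ∈? (b Vec.∷ K))

  down-∷ʳ : ∀ o {n} (K : Subset n) b → down σ o (K Vec.∷ʳ b) ≡ select b (o + n , σ) ++ down σ o K
  down-∷ʳ o Vec.[] b = trans (cong (λ m → select b (m , σ)) (sym (ℕ.+-identityʳ o))) (sym (List.++-identityʳ _))
  down-∷ʳ o {suc n} (c Vec.∷ K) b rewrite down-∷ʳ (suc o) K b | ℕ.+-suc o n = List.++-assoc (select b _) _ _

  up-∷ʳ : ∀ o {n} (K : Subset n) b → up σ o (K Vec.∷ʳ b) ≡ up σ o K ++ select (not b) (o + n , σ)
  up-∷ʳ o Vec.[] b = trans (List.++-identityʳ _) (cong (λ m → select (not b) (m , σ)) (sym (ℕ.+-identityʳ o)))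
  up-∷ʳ o {suc n} (c Vec.∷ K) b rewrite up-∷ʳ (suc o) K b | ℕ.+-suc o n = sym (List.++-assoc (select (not c) _) _ _)

  arrange-down-up : ∀ {n} (K : Subset n) → down σ 0 (Vec.reverse K) ++ up σ 0 (Vec.reverse K) ≡ arrange σ K
  arrange-down-up Vec.[] = refl
  arrange-down-up {suc n} (b Vec.∷ K)
    rewrite Vec.reverse-∷ b K | down-∷ʳ 0 (Vec.reverse K) b | up-∷ʳ 0 (Vec.reverse K) b
    with b
  ... | true  = cong ((n , σ) ∷_) (trans (cong (down σ 0 (Vec.reverse K) ++_) (List.++-identityʳ _)) (arrange-down-up K))
  ... | false = trans (sym (List.++-assoc (down σ 0 (Vec.reverse K)) _ _)) (cong (_++ [ n , σ ]) (arrange-down-up K))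

-- Ladders as words on numbered letters

-- Numbering `a` above all `a[ k ]` makes it the outermost letter, so that a ladder is itself a
-- `word` on one more letter, with `true` as both heads.
letter : ∀ {n} → Letter n → ℕ
letter {n} a    = n
letter     a[ k ] = toℕ k

letter-injective : ∀ {n} → Injective _≡_ _≡_ (letter {n})
letter-injective {x = a}    {y = a}    eq = refl
letter-injective {x = a}    {y = a[ k ]} eq = contradiction (sym eq) (ℕ.<⇒≢ (Fin.toℕ<n k))
letter-injective {x = a[ k ]} {y = a}    eq = contradiction eq (ℕ.<⇒≢ (Fin.toℕ<n k))
letter-injective {x = a[ j ]} {y = a[ k ]} eq = cong a[_] (Fin.toℕ-injective eq)

relabelℕ : ∀ {n} → Word (Letter n) → Word ℕ
relabelℕ = map (map₁ letter)

block-relabel : ∀ σ {n} (K : Subset n) →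
  relabelℕ (map (λ k → a[ k ] , σ) (filter (_∈? Vec.reverse K) (reverse (allFin n)))
             ++ map (λ k → a[ k ] , σ) (filter (λ k → ¬? (k ∈? Vec.reverse K)) (allFin n)))
    ≡ arrange σ K
block-relabel σ {n} K =
  trans (List.map-++ (map₁ letter) (map side ks) (map side ks′))
    (trans (cong₂ _++_ (trans (sym (List.map-∘ ks)) (filter-down σ 0 (Vec.reverse K)))
                       (trans (sym (List.map-∘ ks′)) (filter-up σ 0 (Vec.reverse K))))
      (arrange-down-up σ K))
  where
  side : Fin n → Side (Letter n)
  side k = a[ k ] , σ
  ks ks′ : List (Fin n)
  ks  = filter (_∈? Vec.reverse K) (reverse (allFin n))
  ks′ = filter (λ k → ¬? (k ∈? Vec.reverse K)) (allFin n)

ladder-relabel : ∀ {n} (K T : Subset n) →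
  relabelℕ (ladder (Vec.reverse K) (Vec.reverse T)) ≡ word (true Vec.∷ K) (true Vec.∷ T)
ladder-relabel {n} K T = cong ((n , Sign.+) ∷_)
  (trans (cong relabelℕ (sym (List.++-assoc (R₁ K′) (R₂ K′) _)))
    (trans (List.map-++ (map₁ letter) (R₁ K′ ++ R₂ K′) _)
      (cong₂ (λ u v → u ++ (n , Sign.-) ∷ v) (block-relabel Sign.+ K) (block-relabel Sign.- T))))
  where
  K′ = Vec.reverse K

arrange-sign : ∀ σ {n} (K : Subset n) → All (λ s → proj₂ s ≡ σ) (arrange σ K)
arrange-sign σ Vec.[]      = []
arrange-sign σ (b Vec.∷ K) = insert-all b refl (arrange-sign σ K)

insert-here : ∀ {A : Set} b {x : A} xs → x ∈ insert b x xs
insert-here true  xs = here refl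
insert-here false xs = ∈-++⁺ʳ xs (here refl)

insert-there : ∀ {A : Set} b {x y : A} {xs} → y ∈ xs → y ∈ insert b x xs
insert-there true  y∈xs = there y∈xs
insert-there false y∈xs = ∈-++⁺ˡ y∈xs

arrange-∈ : ∀ σ {n} (K : Subset n) {j} → j < n → (j , σ) ∈ arrange σ K
arrange-∈ σ {suc n} (b Vec.∷ K) {j} j<1+n with ℕ.m≤n⇒m<n∨m≡n (ℕ.≤-pred j<1+n)
... | inj₁ j<n  = insert-there b (arrange-∈ σ K j<n)
... | inj₂ refl = insert-here b _

insert-unique : ∀ {A : Set} b {x : A} {xs} → All (x ≢_) xs → Unique xs → Unique (insert b x xs)
insert-unique true  x∉xs xs! = x∉xs ∷ xs!
insert-unique false x∉xs xs! =
  Unique.++⁺ xs! ([] ∷ []) λ { (y∈xs , here refl) → All.lookup x∉xs y∈xs refl }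

arrange-unique : ∀ σ {n} (K : Subset n) → Unique (arrange σ K)
arrange-unique σ Vec.[]      = []
arrange-unique σ (b Vec.∷ K) = insert-unique b
  (All.map (λ j<n eq → ℕ.<⇒≢ j<n (cong proj₁ (sym eq))) (arrange-< σ K)) (arrange-unique σ K)

word-unique : ∀ {n} (K T : Subset n) → Unique (word K T)
word-unique K T = Unique.++⁺ (arrange-unique Sign.+ K) (arrange-unique Sign.- T)
  λ { (s∈K , s∈T) → contradiction (trans (sym (All.lookup (arrange-sign Sign.+ K) s∈K))
                                          (All.lookup (arrange-sign Sign.- T) s∈T)) λ () }

word-⁻ : ∀ {n} (K T : Subset n) {s} → s ∈ word K T → s ⁻ ∈ word K T
word-⁻ K T s∈ with ∈-++⁻ (arrange Sign.+ K) s∈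
... | inj₁ s∈K rewrite All.lookup (arrange-sign Sign.+ K) s∈K =
  ∈-++⁺ʳ (arrange Sign.+ K) (arrange-∈ Sign.- T (All.lookup (arrange-< Sign.+ K) s∈K))
... | inj₂ s∈T rewrite All.lookup (arrange-sign Sign.- T) s∈T =
  ∈-++⁺ˡ (arrange-∈ Sign.+ K (All.lookup (arrange-< Sign.- T) s∈T))

-- Edges and Euler characteristic

-- `numEdges` freed from the decidable equality of its module, to be compared across alphabets.
edges : {A : Set} → Word A → ℕ
edges w = length (filter (λ s → proj₂ s Sign.≟ Sign.+) w)

edges-relabel : ∀ {n} (w : Word (Letter n)) → edges (relabelℕ w) ≡ edges w
edges-relabel w = trans (cong length (filter-map positive? positive? (map₁ letter) (λ _ → refl) w))
                        (List.length-map (map₁ letter) (filter positive? w))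
  where
  positive? : ∀ {A : Set} → Decidable (λ (s : Side A) → proj₂ s ≡ Sign.+)
  positive? s = proj₂ s Sign.≟ Sign.+

edges-++ : ∀ {A : Set} (u v : Word A) → edges (u ++ v) ≡ edges u + edges v
edges-++ u v = trans (cong length (List.filter-++ _ u v)) (List.length-++ (filter (λ s → proj₂ s Sign.≟ Sign.+) u))

length-insert : ∀ {A : Set} b {x : A} xs → length (insert b x xs) ≡ suc (length xs)
length-insert true  xs = refl
length-insert false xs = trans (List.length-++ xs) (ℕ.+-comm _ 1)

length-arrange : ∀ σ {n} (K : Subset n) → length (arrange σ K) ≡ n
length-arrange σ Vec.[]      = refl
length-arrange σ (b Vec.∷ K) = trans (length-insert b (arrange σ K)) (cong suc (length-arrange σ K))

edges-word : ∀ {n} (K T : Subset n) → edges (word K T) ≡ n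
edges-word {n} K T = begin
  edges (word K T)                                 ≡⟨ edges-++ (arrange Sign.+ K) _ ⟩
  edges (arrange Sign.+ K) + edges (arrange Sign.- T)
    ≡⟨ cong₂ _+_ (cong length (List.filter-all _ (arrange-sign Sign.+ K)))
                 (cong length (List.filter-none _ (All.map (λ { refl () }) (arrange-sign Sign.- T)))) ⟩
  length (arrange Sign.+ K) + 0                    ≡⟨ ℕ.+-identityʳ _ ⟩
  length (arrange Sign.+ K)                        ≡⟨ length-arrange Sign.+ K ⟩
  n ∎
  where open ≡-Reasoning

euler-formula : ∀ v e g → v + 2 * g ≡ suc e → + v ℤ.- + e ℤ.+ + 1 ≡ + 2 ℤ.- + (2 * g)
euler-formula v e g eq = begin
  + v ℤ.- + e ℤ.+ + 1                           ≡⟨ regroup (+ v) (+ e) (+ (2 * g)) ⟩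
  (+ v ℤ.+ + (2 * g)) ℤ.- + e ℤ.+ + 1 ℤ.- + (2 * g)
    ≡⟨ cong (λ m → + m ℤ.- + e ℤ.+ + 1 ℤ.- + (2 * g)) eq ⟩
  (+ 1 ℤ.+ + e) ℤ.- + e ℤ.+ + 1 ℤ.- + (2 * g)   ≡⟨ cancel (+ e) (+ (2 * g)) ⟩
  + 2 ℤ.- + (2 * g)                             ∎
  where
  open ≡-Reasoning
  regroup : ∀ v e x → v ℤ.- e ℤ.+ + 1 ≡ (v ℤ.+ x) ℤ.- e ℤ.+ + 1 ℤ.- x
  regroup = ℤ-solve-∀
  cancel : ∀ e x → (+ 1 ℤ.+ e) ℤ.- e ℤ.+ + 1 ℤ.- x ≡ + 2 ℤ.- x
  cancel = ℤ-solve-∀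

module _ {n : ℕ} (K T : Subset n) where
  open Genus (_≟ₗ_ {n})

  private
    w : Word (Letter n)
    w = ladder (Vec.reverse K) (Vec.reverse T)
    open HasVertices (framed-vertices (n , Sign.+) ℕ.≤-refl K T)

    numVertices-ladder : numVertices w ≡ count
    numVertices-ladder = numVertices-vertices _≟ₗ_ letter letter-injective (a , Sign.+) _
      (subst (λ w → Vertices w count) (sym relabelled) vertices)
      (subst Unique (sym relabelled) (word-unique (true Vec.∷ K) (true Vec.∷ T)))
      (λ {s} s∈ → subst (s ⁻ ∈_) (sym relabelled)
         (word-⁻ (true Vec.∷ K) (true Vec.∷ T) (subst (s ∈_) relabelled s∈)))
      where
      relabelled = ladder-relabel K T

    numEdges-ladder : numEdges w ≡ suc n
    numEdges-ladder = trans (sym (edges-relabel w))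
      (trans (cong edges (ladder-relabel K T)) (edges-word (true Vec.∷ K) (true Vec.∷ T)))

  eulerCharacteristic-ladder : eulerCharacteristic w ≡ + 2 ℤ.- + (2 * framedGenus K T)
  eulerCharacteristic-ladder =
    trans (cong₂ (λ v e → + v ℤ.- + e ℤ.+ + 1) numVertices-ladder numEdges-ladder)
          (euler-formula count (suc n) (framedGenus K T) euler)

  genus-framedGenus : ∀ {g} → HasGenus g w → framedGenus K T ≡ g
  genus-framedGenus {g} hasGenus = ℕ.*-cancelˡ-≡ _ g 2 (ℤ.+-injective (ℤ.neg-injective
    (∙-cancelˡ (+ 2) _ _ (trans (sym eulerCharacteristic-ladder) hasGenus))))

  framedGenus-genus : ∀ {g} → framedGenus K T ≡ g → HasGenus g w
  framedGenus-genus refl = eulerCharacteristic-ladder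

-- Counting by genus

indicator : {P : Set} → Dec P → ℕ
indicator P? = if does P? then 1 else 0

-- A recursion rather than a list sum, so that splitting by the outermost letter is a computation.
sumSubsets : ∀ n → (Subset n → ℕ) → ℕ
sumSubsets zero    f = f Vec.[]
sumSubsets (suc n) f = sumSubsets n (f ∘ (false Vec.∷_)) + sumSubsets n (f ∘ (true Vec.∷_))

sumSubsets-cong : ∀ n {f g} → (∀ K → f K ≡ g K) → sumSubsets n f ≡ sumSubsets n g
sumSubsets-cong zero    eq = eq Vec.[]
sumSubsets-cong (suc n) eq = cong₂ _+_ (sumSubsets-cong n (eq ∘ (false Vec.∷_))) (sumSubsets-cong n (eq ∘ (true Vec.∷_)))

interchange : ∀ a b c d → (a + b) + (c + d) ≡ (a + c) + (b + d)
interchange = solve-∀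

sumSubsets-+ : ∀ n f g → sumSubsets n (λ K → f K + g K) ≡ sumSubsets n f + sumSubsets n g
sumSubsets-+ zero    f g = refl
sumSubsets-+ (suc n) f g = trans (cong₂ _+_ (sumSubsets-+ n _ _) (sumSubsets-+ n _ _))
  (interchange (sumSubsets n (f ∘ (false Vec.∷_))) _ _ _)

sumSubsets-0 : ∀ n → sumSubsets n (λ _ → 0) ≡ 0
sumSubsets-0 zero    = refl
sumSubsets-0 (suc n) = cong₂ _+_ (sumSubsets-0 n) (sumSubsets-0 n)

sumSubsets-∷ʳ : ∀ n f → sumSubsets (suc n) f ≡ sumSubsets n (λ K → f (K Vec.∷ʳ false)) + sumSubsets n (λ K → f (K Vec.∷ʳ true))
sumSubsets-∷ʳ zero    f = refl
sumSubsets-∷ʳ (suc n) f = trans (cong₂ _+_ (sumSubsets-∷ʳ n (f ∘ (false Vec.∷_))) (sumSubsets-∷ʳ n (f ∘ (true Vec.∷_))))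
  (interchange (sumSubsets n (λ K → f (false Vec.∷ (K Vec.∷ʳ false)))) _ _ _)

-- Reversal exchanges the first and the last entry, and the sum may be split along either.
sumSubsets-reverse : ∀ n f → sumSubsets n (f ∘ Vec.reverse) ≡ sumSubsets n f
sumSubsets-reverse zero    f = refl
sumSubsets-reverse (suc n) f = trans (cong₂ _+_ (step false) (step true)) (sym (sumSubsets-∷ʳ n f))
  where
  step : ∀ b → sumSubsets n (λ K → f (Vec.reverse (b Vec.∷ K))) ≡ sumSubsets n (λ K → f (K Vec.∷ʳ b))
  step b = trans (sumSubsets-cong n (λ K → cong f (Vec.reverse-∷ b K))) (sumSubsets-reverse n (λ K → f (K Vec.∷ʳ b)))

sum-subsets : ∀ n f → sum (map f (subsets n)) ≡ sumSubsets n f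
sum-subsets zero    f = ℕ.+-identityʳ (f Vec.[])
sum-subsets (suc n) f = begin
  sum (map f (map (false Vec.∷_) (subsets n) ++ map (true Vec.∷_) (subsets n)))
    ≡⟨ cong sum (List.map-++ f (map (false Vec.∷_) (subsets n)) _) ⟩
  sum (map f (map (false Vec.∷_) (subsets n)) ++ map f (map (true Vec.∷_) (subsets n)))
    ≡⟨ ListAction.sum-++ (map f (map (false Vec.∷_) (subsets n))) _ ⟩
  sum (map f (map (false Vec.∷_) (subsets n))) + sum (map f (map (true Vec.∷_) (subsets n)))
    ≡⟨ cong₂ (λ xs ys → sum xs + sum ys) (List.map-∘ (subsets n)) (List.map-∘ (subsets n)) ⟨
  sum (map (f ∘ (false Vec.∷_)) (subsets n)) + sum (map (f ∘ (true Vec.∷_)) (subsets n))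
    ≡⟨ cong₂ _+_ (sum-subsets n _) (sum-subsets n _) ⟩
  sumSubsets (suc n) f ∎
  where open ≡-Reasoning

module _ {A B C : Set} {P : Pred C 0ℓ} (P? : Decidable P) where

  length-filter-map : ∀ (f : B → C) ys → length (filter P? (map f ys)) ≡ sum (map (indicator ∘ P? ∘ f) ys)
  length-filter-map f []       = refl
  length-filter-map f (y ∷ ys) with does (P? (f y))
  ... | true  = cong suc (length-filter-map f ys)
  ... | false = length-filter-map f ys

  length-filter-product : ∀ (f : A → B → C) xs ys → length (filter P? (cartesianProductWith f xs ys)) ≡
                          sum (map (λ x → sum (map (λ y → indicator (P? (f x y))) ys)) xs)
  length-filter-product f []       ys = refl
  length-filter-product f (x ∷ xs) ys =
    trans (cong length (List.filter-++ P? (map (f x) ys) _))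
      (trans (List.length-++ (filter P? (map (f x) ys)))
        (cong₂ _+_ (length-filter-map (f x) ys) (length-filter-product f xs ys)))

countPairs : ∀ n → (Subset n → Subset n → ℕ) → ℕ → ℕ
countPairs n genus g = sumSubsets n λ K → sumSubsets n λ T → indicator (genus K T ℕ.≟ g)

wordCount framedCount : ℕ → ℕ → ℕ
wordCount n   = countPairs n wordGenus
framedCount n = countPairs n framedGenus

genusCount-framedCount : ∀ n g → genusCount n g ≡ framedCount n g
genusCount-framedCount n g = begin
  genusCount n g
    ≡⟨ length-filter-product (hasGenus? g) ladder (subsets n) (subsets n) ⟩
  sum (map (λ K → sum (map (λ T → f K T) (subsets n))) (subsets n))
    ≡⟨ sum-subsets n _ ⟩
  sumSubsets n (λ K → sum (map (λ T → f K T) (subsets n)))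
    ≡⟨ sumSubsets-cong n (λ K → sum-subsets n (f K)) ⟩
  sumSubsets n (λ K → sumSubsets n (f K))
    ≡⟨ sumSubsets-reverse n _ ⟨
  sumSubsets n (λ K → sumSubsets n (f (Vec.reverse K)))
    ≡⟨ sumSubsets-cong n (λ K → sumSubsets-reverse n (f (Vec.reverse K))) ⟨
  sumSubsets n (λ K → sumSubsets n (λ T → f (Vec.reverse K) (Vec.reverse T)))
    ≡⟨ sumSubsets-cong n (λ K → sumSubsets-cong n (λ T → cong (λ b → if b then 1 else 0)
         (does-⇔ (mk⇔ (genus-framedGenus K T) (framedGenus-genus K T))
           (hasGenus? g (ladder (Vec.reverse K) (Vec.reverse T))) (framedGenus K T ℕ.≟ g)))) ⟩
  framedCount n g ∎
  where
  open ≡-Reasoning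
  open Genus (_≟ₗ_ {n})
  f : Subset n → Subset n → ℕ
  f K T = indicator (hasGenus? g (ladder K T))

countPairs-suc : ∀ n genus g → countPairs (suc n) genus g ≡
  (countPairs n (λ K T → genus (false Vec.∷ K) (false Vec.∷ T)) g + countPairs n (λ K T → genus (false Vec.∷ K) (true Vec.∷ T)) g)
  + (countPairs n (λ K T → genus (true Vec.∷ K) (false Vec.∷ T)) g + countPairs n (λ K T → genus (true Vec.∷ K) (true Vec.∷ T)) g)
countPairs-suc n genus g = cong₂ _+_ (sumSubsets-+ n _ _) (sumSubsets-+ n _ _)

wordCount-suc : ∀ n g → wordCount (suc n) g ≡ 2 * framedCount n g + 2 * wordCount n g
wordCount-suc n g = trans (countPairs-suc n wordGenus g) (regroup (framedCount n g) (wordCount n g))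
  where
  regroup : ∀ x y → (x + y) + (y + x) ≡ 2 * x + 2 * y
  regroup = solve-∀

framedCount-suc : ∀ n g → framedCount (suc n) (suc g) ≡ 4 * wordCount n g
framedCount-suc n g = trans (countPairs-suc n framedGenus (suc g)) (regroup (wordCount n g))
  where
  regroup : ∀ x → (x + x) + (x + x) ≡ 4 * x
  regroup = solve-∀

framedCount-0 : ∀ n → framedCount (suc n) 0 ≡ 0
framedCount-0 n = trans (countPairs-suc n framedGenus 0) (cong₂ _+_ (cong₂ _+_ zeros zeros) (cong₂ _+_ zeros zeros))
  where
  zeros : sumSubsets n (λ _ → sumSubsets n (λ _ → 0)) ≡ 0
  zeros = trans (sumSubsets-cong n (λ _ → sumSubsets-0 n)) (sumSubsets-0 n)

-- Elimination of `framedCount`: a frame costs a factor 2 and its handle a factor 4, hence the 8.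
wordCount-2+ : ∀ n i → wordCount (2 + n) (suc i) ≡ 8 * wordCount n i + 2 * wordCount (suc n) (suc i)
wordCount-2+ n i = trans (wordCount-suc (suc n) (suc i))
  (cong (_+ 2 * wordCount (suc n) (suc i)) (trans (cong (2 *_) (framedCount-suc n i)) (sym (ℕ.*-assoc 2 4 (wordCount n i)))))

-- size i d = 2 i + d and scale i d = 2 ^ (3 i + d), in the form in which the
-- recurrence of wordCount produces them.

size : ℕ → ℕ → ℕ
size zero    d = d
size (suc i) d = 2 + size i d

size-suc : ∀ i d → size i (suc d) ≡ suc (size i d)
size-suc zero    d = refl
size-suc (suc i) d = cong (λ n → 2 + n) (size-suc i d)

scale : ℕ → ℕ → ℕ
scale zero    d = 2 ^ d
scale (suc i) d = 8 * scale i d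

scale-suc : ∀ i d → scale i (suc d) ≡ 2 * scale i d
scale-suc zero    d = refl
scale-suc (suc i) d = trans (cong (8 *_) (scale-suc i d)) (swap (scale i d))
  where
  swap : ∀ x → 8 * (2 * x) ≡ 2 * (8 * x)
  swap = solve-∀

-- C(i + d, i) + C(i + d - 1, i), the entries of the Lucas triangle.
lucas : ℕ → ℕ → ℕ
lucas zero    zero    = 1
lucas zero    (suc d) = 2
lucas (suc i) zero    = 1
lucas (suc i) (suc d) = lucas (suc i) d + lucas i (suc d)

wordCount-0 : ∀ d → wordCount d 0 ≡ 2 ^ d * lucas 0 d
wordCount-0 zero    = refl
wordCount-0 (suc zero) = refl
wordCount-0 (suc (suc d)) = trans (wordCount-suc (suc d) 0)
  (trans (cong₂ (λ x y → 2 * x + 2 * y) (framedCount-0 d) (wordCount-0 (suc d))) (sym (ℕ.*-assoc 2 (2 ^ suc d) 2)))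

-- Each handle uses up two letters.
wordCount-vanishes : ∀ n i → n < size i 0 → wordCount n i ≡ 0
wordCount-vanishes zero          (suc i) n<  = refl
wordCount-vanishes (suc zero)    (suc i) n<  = refl
wordCount-vanishes (suc (suc n)) (suc i) (s≤s (s≤s n<)) = trans (wordCount-2+ n i)
  (cong₂ (λ x y → 8 * x + 2 * y) (wordCount-vanishes n i n<)
    (wordCount-vanishes (suc n) (suc i) (s≤s (ℕ.m≤n⇒m≤1+n n<))))

-- In the coordinates `i` and `d` the two terms of `wordCount-2+` come from lowering `i` or `d` by
-- one. `scale` absorbs the factors 8 and 2, and what remains is the Pascal rule of `lucas`.
wordCount-lucas : ∀ i d → wordCount (size i d) i ≡ scale i d * lucas i d
wordCount-lucas zero    d       = wordCount-0 d
wordCount-lucas (suc i) zero    = begin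
  wordCount (2 + size i 0) (suc i)                              ≡⟨ wordCount-2+ (size i 0) i ⟩
  8 * wordCount (size i 0) i + 2 * wordCount (suc (size i 0)) (suc i)
    ≡⟨ cong₂ (λ x y → 8 * x + 2 * y) (wordCount-lucas i 0) (wordCount-vanishes (suc (size i 0)) (suc i) (ℕ.n<1+n _)) ⟩
  8 * (scale i 0 * lucas i 0) + 0                               ≡⟨ cong (λ l → 8 * (scale i 0 * l) + 0) (lucas-0 i) ⟩
  8 * (scale i 0 * 1) + 0                                       ≡⟨ regroup (scale i 0) ⟩
  8 * scale i 0 * 1                                             ∎
  where
  open ≡-Reasoning
  lucas-0 : ∀ i → lucas i 0 ≡ 1
  lucas-0 zero    = refl
  lucas-0 (suc i) = refl
  regroup : ∀ x → 8 * (x * 1) + 0 ≡ 8 * x * 1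
  regroup = solve-∀
wordCount-lucas (suc i) (suc d) = begin
  wordCount (2 + size i (suc d)) (suc i)                        ≡⟨ wordCount-2+ (size i (suc d)) i ⟩
  8 * wordCount (size i (suc d)) i + 2 * wordCount (suc (size i (suc d))) (suc i)
    ≡⟨ cong₂ (λ x y → 8 * x + 2 * y) (wordCount-lucas i (suc d))
         (trans (cong (λ n → wordCount (suc n) (suc i)) (size-suc i d)) (wordCount-lucas (suc i) d)) ⟩
  8 * (scale i (suc d) * lucas i (suc d)) + 2 * (8 * scale i d * lucas (suc i) d)
    ≡⟨ cong (λ s → 8 * (s * lucas i (suc d)) + 2 * (8 * scale i d * lucas (suc i) d)) (scale-suc i d) ⟩
  8 * (2 * scale i d * lucas i (suc d)) + 2 * (8 * scale i d * lucas (suc i) d)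
    ≡⟨ regroup (scale i d) (lucas i (suc d)) (lucas (suc i) d) ⟩
  8 * (2 * scale i d) * (lucas (suc i) d + lucas i (suc d))
    ≡⟨ cong (λ s → 8 * s * lucas (suc i) (suc d)) (scale-suc i d) ⟨
  8 * scale i (suc d) * lucas (suc i) (suc d)                   ∎
  where
  open ≡-Reasoning
  regroup : ∀ s x y → 8 * (2 * s * x) + 2 * (8 * s * y) ≡ 8 * (2 * s) * (y + x)
  regroup = solve-∀

-- Ratios of consecutive counts

mutual
  -- The closed form (i + 2d)(i + d - 1)! / (i! d!) with denominators cleared, by induction along
  -- the Pascal rule. Making `i` a successor here, and `d` in `lucas-!′`, avoids the predecessor in
  -- the factorial.
  lucas-! : ∀ i d → lucas (suc i) d * (suc i ! * d !) ≡ (suc i + 2 * d) * (i + d) !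
  lucas-! i zero = begin
    1 * (suc i ! * 1)               ≡⟨ units i (i !) ⟩
    (suc i + 2 * 0) * i !           ≡⟨ cong (λ m → (suc i + 2 * 0) * m !) (ℕ.+-identityʳ i) ⟨
    (suc i + 2 * 0) * (i + 0) !     ∎
    where
    open ≡-Reasoning
    units : ∀ i f → 1 * ((1 + i) * f * 1) ≡ (1 + i + 2 * 0) * f
    units = solve-∀
  lucas-! i (suc d) = begin
    (lucas (suc i) d + lucas i (suc d)) * (suc i ! * suc d !)
      ≡⟨ expand (lucas (suc i) d) (lucas i (suc d)) i d (i !) (d !) ⟩
    suc d * (lucas (suc i) d * (suc i ! * d !)) + suc i * (lucas i (suc d) * (i ! * suc d !))
      ≡⟨ cong₂ (λ x y → suc d * x + suc i * y) (lucas-! i d) (lucas-!′ i d) ⟩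
    suc d * ((suc i + 2 * d) * (i + d) !) + suc i * ((i + 2 * suc d) * (i + d) !)
      ≡⟨ collect i d ((i + d) !) ⟩
    (suc i + 2 * suc d) * (suc (i + d) * (i + d) !)
      ≡⟨ cong (λ m → (suc i + 2 * suc d) * m !) (ℕ.+-suc i d) ⟨
    (suc i + 2 * suc d) * (i + suc d) ! ∎
    where
    open ≡-Reasoning
    expand : ∀ x y i d f g → (x + y) * ((1 + i) * f * ((1 + d) * g)) ≡
             (1 + d) * (x * ((1 + i) * f * g)) + (1 + i) * (y * (f * ((1 + d) * g)))
    expand = solve-∀
    collect : ∀ i d f → (1 + d) * ((1 + i + 2 * d) * f) + (1 + i) * ((i + 2 * (1 + d)) * f) ≡
              (1 + i + 2 * (1 + d)) * ((1 + (i + d)) * f)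
    collect = solve-∀

  lucas-!′ : ∀ i d → lucas i (suc d) * (i ! * suc d !) ≡ (i + 2 * suc d) * (i + d) !
  lucas-!′ zero    d = units d (d !)
    where
    units : ∀ d f → 2 * (1 * ((1 + d) * f)) ≡ (0 + 2 * (1 + d)) * f
    units = solve-∀
  lucas-!′ (suc i) d = trans (lucas-! i (suc d)) (cong (λ m → (suc i + 2 * suc d) * m !) (ℕ.+-suc i d))

term : ℕ → ℕ → ℕ
term i d = wordCount (size i d) i

-- `num i d / den i d` is the ratio of `term (suc i) d` to `term i (2 + d)`, neighbours in one row
-- since both have size 2i + d + 2. It is the quotient of the closed forms of `lucas`; the factor 2
-- is the quotient 8 / 4 of the scales.
den num : ℕ → ℕ → ℕ
den i d = (1 + i) * (i + 2 * d + 4) * (i + d + 1)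
num i d = 2 * ((1 + i + 2 * d) * (d + 2) * (d + 1))

lucas-ratio : ∀ i d → 2 * (lucas (suc i) d * den i d) ≡ lucas i (2 + d) * num i d
lucas-ratio i d = ℕ.*-cancelʳ-≡ _ _ (i ! * d !) {{ℕ.m*n≢0 (i !) (d !) {{i ℕ.!≢0}} {{d ℕ.!≢0}}}} (begin
  2 * (lucas (suc i) d * den i d) * (i ! * d !)
    ≡⟨ left (lucas (suc i) d) i d (i !) (d !) ⟩
  2 * (lucas (suc i) d * (suc i ! * d !)) * ((i + 2 * d + 4) * (i + d + 1))
    ≡⟨ cong (λ x → 2 * x * ((i + 2 * d + 4) * (i + d + 1))) (lucas-! i d) ⟩
  2 * ((suc i + 2 * d) * (i + d) !) * ((i + 2 * d + 4) * (i + d + 1))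
    ≡⟨ middle i d ((i + d) !) ⟩
  (i + 2 * suc (suc d)) * (suc (i + d) !) * (2 * (1 + i + 2 * d))
    ≡⟨ cong (λ m → (i + 2 * suc (suc d)) * m ! * (2 * (1 + i + 2 * d))) (ℕ.+-suc i d) ⟨
  (i + 2 * suc (suc d)) * (i + suc d) ! * (2 * (1 + i + 2 * d))
    ≡⟨ cong (_* (2 * (1 + i + 2 * d))) (lucas-!′ i (suc d)) ⟨
  lucas i (2 + d) * (i ! * suc (suc d) !) * (2 * (1 + i + 2 * d))
    ≡⟨ right (lucas i (2 + d)) i d (i !) (d !) ⟩
  lucas i (2 + d) * num i d * (i ! * d !) ∎)
  where
  open ≡-Reasoning
  left : ∀ x i d f g → 2 * (x * ((1 + i) * (i + 2 * d + 4) * (i + d + 1))) * (f * g) ≡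
         2 * (x * ((1 + i) * f * g)) * ((i + 2 * d + 4) * (i + d + 1))
  left = solve-∀
  middle : ∀ i d h → 2 * ((1 + i + 2 * d) * h) * ((i + 2 * d + 4) * (i + d + 1)) ≡
           (i + 2 * (2 + d)) * ((1 + (i + d)) * h) * (2 * (1 + i + 2 * d))
  middle = solve-∀
  right : ∀ y i d f g → y * (f * ((2 + d) * ((1 + d) * g))) * (2 * (1 + i + 2 * d)) ≡
          y * (2 * ((1 + i + 2 * d) * (d + 2) * (d + 1))) * (f * g)
  right = solve-∀

term-ratio : ∀ i d → term (suc i) d * den i d ≡ term i (2 + d) * num i d
term-ratio i d = begin
  term (suc i) d * den i d                       ≡⟨ cong (_* den i d) (wordCount-lucas (suc i) d) ⟩
  8 * scale i d * lucas (suc i) d * den i d      ≡⟨ left (scale i d) (lucas (suc i) d) (den i d) ⟩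
  4 * scale i d * (2 * (lucas (suc i) d * den i d))
    ≡⟨ cong (4 * scale i d *_) (lucas-ratio i d) ⟩
  4 * scale i d * (lucas i (2 + d) * num i d)    ≡⟨ right (scale i d) (lucas i (2 + d)) (num i d) ⟩
  2 * (2 * scale i d) * lucas i (2 + d) * num i d
    ≡⟨ cong (λ s → s * lucas i (2 + d) * num i d) (trans (scale-suc i (suc d)) (cong (2 *_) (scale-suc i d))) ⟨
  scale i (2 + d) * lucas i (2 + d) * num i d    ≡⟨ cong (_* num i d) (wordCount-lucas i (2 + d)) ⟨
  term i (2 + d) * num i d                       ∎
  where
  open ≡-Reasoning
  left : ∀ s x a → 8 * s * x * a ≡ 4 * s * (2 * (x * a))
  left = solve-∀
  right : ∀ s y b → 4 * s * (y * b) ≡ 2 * (2 * s) * y * b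
  right = solve-∀

scale-positive : ∀ i d → 0 < scale i d
scale-positive zero    d = ℕ.m^n>0 2 d
scale-positive (suc i) d = ℕ.*-mono-< {0} {8} {0} (s≤s z≤n) (scale-positive i d)

lucas-positive : ∀ i d → 0 < lucas i d
lucas-positive zero    zero    = s≤s z≤n
lucas-positive zero    (suc d) = s≤s z≤n
lucas-positive (suc i) zero    = s≤s z≤n
lucas-positive (suc i) (suc d) = ℕ.<-≤-trans (lucas-positive (suc i) d) (ℕ.m≤m+n _ _)

term-positive : ∀ i d → 0 < term i d
term-positive i d = subst (0 <_) (sym (wordCount-lucas i d)) (ℕ.*-mono-< (scale-positive i d) (lucas-positive i d))

term-nonZero : ∀ {i d} → NonZero (term i d)
term-nonZero {i} {d} = >-nonZero (term-positive i d)

den-nonZero : ∀ i d → NonZero (den i d)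
den-nonZero i d = ℕ.m*n≢0 _ _ {{ℕ.m*n≢0 (1 + i) _ {{_}} {{≢-nonZero λ eq → ℕ.1+n≢0 (trans (sym (ℕ.+-suc (i + 2 * d) 3)) eq)}}}}
                              {{≢-nonZero λ eq → ℕ.1+n≢0 (trans (ℕ.+-comm 1 (i + d)) eq)}}

-- Comparison of the ratio with 1

-- For `d = i + e` the difference is a polynomial with nonnegative coefficients. Its linear part
-- `3 * i + 8 * e` stands first because it alone gives strictness when `d` is positive; at
-- `i = e = 0` everything vanishes.
ascent : ∀ i e → num i (i + e) ≡ den i (i + e) +
         (3 * i + 8 * e + (9 * i * i * e + 12 * i * e * e + 4 * e * e * e + 3 * i * i + 21 * i * e + 12 * e * e))
ascent = lemma
  where
  lemma : ∀ i e → 2 * ((1 + i + 2 * (i + e)) * ((i + e) + 2) * ((i + e) + 1)) ≡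
         (1 + i) * (i + 2 * (i + e) + 4) * (i + (i + e) + 1) +
         (3 * i + 8 * e + (9 * i * i * e + 12 * i * e * e + 4 * e * e * e + 3 * i * i + 21 * i * e + 12 * e * e))
  lemma = solve-∀

-- For `i = d + 1 + e` the difference again has nonnegative coefficients, and its constant 12 makes
-- the fall strict.
descent : ∀ d e → den (suc d + e) d ≡ num (suc d + e) d +
          (12 + (9 * d * d * e + 6 * d * e * e + e * e * e + 6 * d * d + 27 * d * e + 9 * e * e + 18 * d + 20 * e))
descent = lemma
  where
  lemma : ∀ d e → (1 + (1 + d + e)) * ((1 + d + e) + 2 * d + 4) * ((1 + d + e) + d + 1) ≡
          2 * ((1 + (1 + d + e) + 2 * d) * (d + 2) * (d + 1)) +
          (12 + (9 * d * d * e + 6 * d * e * e + e * e * e + 6 * d * d + 27 * d * e + 9 * e * e + 18 * d + 20 * e))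
  lemma = solve-∀

den≤num : ∀ {i d} → i ≤ d → den i d ≤ num i d
den≤num {i} i≤d with e , refl ← ℕ.m≤n⇒∃[o]m+o≡n i≤d =
  subst (den i (i + e) ≤_) (sym (ascent i e)) (ℕ.m≤m+n _ _)

den<num : ∀ {i d} → i ≤ d → 0 < d → den i d < num i d
den<num {i} {d} i≤d 0<d with e , refl ← ℕ.m≤n⇒∃[o]m+o≡n i≤d =
  subst (den i (i + e) <_) (sym (ascent i e)) (ℕ.m<m+n _ (ℕ.<-≤-trans 0<d (ℕ.≤-trans i+e≤ (ℕ.m≤m+n _ _))))
  where
  i+e≤ : i + e ≤ 3 * i + 8 * e
  i+e≤ = ℕ.+-mono-≤ (ℕ.m≤m+n i _) (ℕ.m≤m+n e _)

num<den : ∀ {i d} → d < i → num i d < den i d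
num<den {i} {d} d<i with e , refl ← ℕ.m≤n⇒∃[o]m+o≡n d<i =
  subst (num (suc d + e) d <_) (sym (descent d e)) (ℕ.m<m+n _ (s≤s z≤n))

term-ascending : ∀ {i d} → i ≤ d → term i (2 + d) ≤ term (suc i) d
term-ascending {i} {d} i≤d = ℕ.*-cancelʳ-≤ _ _ (den i d) {{den-nonZero i d}}
  (subst (term i (2 + d) * den i d ≤_) (sym (term-ratio i d)) (ℕ.*-monoʳ-≤ (term i (2 + d)) (den≤num i≤d)))

term-rise : ∀ {i d} → i ≤ d → 0 < d → term i (2 + d) < term (suc i) d
term-rise {i} {d} i≤d 0<d = ℕ.*-cancelʳ-< (den i d) _ _
  (subst (term i (2 + d) * den i d <_) (sym (term-ratio i d))
    (ℕ.*-monoʳ-< (term i (2 + d)) {{term-nonZero {i} {2 + d}}} (den<num i≤d 0<d)))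

term-fall : ∀ {i d} → d < i → term (suc i) d < term i (2 + d)
term-fall {i} {d} d<i = ℕ.*-cancelʳ-< (den i d) _ _
  (subst (_< term i (2 + d) * den i d) (sym (term-ratio i d))
    (ℕ.*-monoʳ-< (term i (2 + d)) {{term-nonZero {i} {2 + d}}} (num<den d<i)))

num-positive : ∀ i d → 0 < num i d
num-positive i d = ℕ.*-mono-< {0} {2} {0} (s≤s z≤n) (ℕ.*-mono-< {0} {(1 + i + 2 * d) * (d + 2)} {0}
  (ℕ.*-mono-< {0} {1 + i + 2 * d} {0} (s≤s z≤n) (subst (0 <_) (ℕ.+-comm 2 d) (s≤s z≤n))) (subst (0 <_) (ℕ.+-comm 1 d) (s≤s z≤n)))

-- After cross-multiplication the factors are compared in groups. With u = i + 2d, `square` is the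
-- inequality of arithmetic and geometric means for u + 8 and u + 2; in `product` the gain from
-- `d + 1` to `d + 3` outweighs the loss from `i + d + 3` to `i + d + 2`.
ratio-decreasing : ∀ i d → num (suc i) d * den i (2 + d) ≤ num i (2 + d) * den (suc i) d
ratio-decreasing i d = subst₂ _≤_ (regroup₁ i d) (regroup₂ i d)
  (ℕ.*-monoʳ-≤ 2 (ℕ.*-mono-≤ (ℕ.*-mono-≤ (ℕ.*-mono-≤ (ℕ.n≤1+n (1 + i)) d+2≤) square) product))
  where
  d+2≤ : d + 2 ≤ d + 4
  d+2≤ = ℕ.+-monoʳ-≤ d (s≤s (s≤s z≤n))
  square : (i + 2 * d + 8) * (i + 2 * d + 2) ≤ (i + 2 * d + 5) * (i + 2 * d + 5)
  square = subst ((i + 2 * d + 8) * (i + 2 * d + 2) ≤_) (eq (i + 2 * d)) (ℕ.m≤m+n _ 9)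
    where
    eq : ∀ u → (u + 8) * (u + 2) + 9 ≡ (u + 5) * (u + 5)
    eq = solve-∀
  product : (i + d + 3) * (d + 1) ≤ (i + d + 2) * (d + 3)
  product = subst ((i + d + 3) * (d + 1) ≤_) (eq i d) (ℕ.m≤m+n _ (2 * i + d + 3))
    where
    eq : ∀ i d → (i + d + 3) * (d + 1) + (2 * i + d + 3) ≡ (i + d + 2) * (d + 3)
    eq = solve-∀
  regroup₁ : ∀ i d → 2 * ((1 + i) * (d + 2) * ((i + 2 * d + 8) * (i + 2 * d + 2)) * ((i + d + 3) * (d + 1))) ≡
    2 * ((1 + (1 + i) + 2 * d) * (d + 2) * (d + 1)) * ((1 + i) * (i + 2 * (2 + d) + 4) * (i + (2 + d) + 1))
  regroup₁ = solve-∀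
  regroup₂ : ∀ i d → 2 * ((1 + (1 + i)) * (d + 4) * ((i + 2 * d + 5) * (i + 2 * d + 5)) * ((i + d + 2) * (d + 3))) ≡
    2 * ((1 + i + 2 * (2 + d)) * ((2 + d) + 2) * ((2 + d) + 1)) * ((1 + (1 + i)) * ((1 + i) + 2 * d + 4) * ((1 + i) + d + 1))
  regroup₂ = solve-∀

logConcave-ratio : ∀ x₀ x₁ x₂ {a₀ b₀ a₁ b₁} {{_ : NonZero (b₀ * a₁)}} →
  x₁ * a₀ ≡ x₀ * b₀ → x₂ * a₁ ≡ x₁ * b₁ → b₁ * a₀ ≤ b₀ * a₁ → x₀ * x₂ ≤ x₁ ^ 2
logConcave-ratio x₀ x₁ x₂ {a₀} {b₀} {a₁} {b₁} eq₀ eq₁ decreasing = ℕ.*-cancelʳ-≤ _ _ (b₀ * a₁) (begin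
  x₀ * x₂ * (b₀ * a₁)       ≡⟨ regroup₁ x₀ x₂ b₀ a₁ ⟩
  (x₀ * b₀) * (x₂ * a₁)     ≡⟨ cong₂ _*_ (sym eq₀) eq₁ ⟩
  (x₁ * a₀) * (x₁ * b₁)     ≡⟨ regroup₂ x₁ a₀ b₁ ⟩
  x₁ ^ 2 * (b₁ * a₀)        ≤⟨ ℕ.*-monoʳ-≤ (x₁ ^ 2) decreasing ⟩
  x₁ ^ 2 * (b₀ * a₁)        ∎)
  where
  open ℕ.≤-Reasoning
  regroup₁ : ∀ x y b a → x * y * (b * a) ≡ (x * b) * (y * a)
  regroup₁ = solve-∀
  regroup₂ : ∀ x a b → (x * a) * (x * b) ≡ x * (x * 1) * (b * a)
  regroup₂ = solve-∀

term-logConcave : ∀ i d → term i (4 + d) * term (2 + i) d ≤ term (1 + i) (2 + d) ^ 2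
term-logConcave i d = logConcave-ratio (term i (4 + d)) (term (1 + i) (2 + d)) (term (2 + i) d)
  {{ℕ.m*n≢0 _ _ {{>-nonZero (num-positive i (2 + d))}} {{den-nonZero (suc i) d}}}}
  (term-ratio i (2 + d)) (term-ratio (suc i) d) (ratio-decreasing i d)

-- The genus distribution

size-≡ : ∀ i d → size i d ≡ 2 * i + d
size-≡ zero    d = refl
size-≡ (suc i) d = trans (cong (λ n → 2 + n) (size-≡ i d)) (cong (_+ d) (sym (ℕ.*-suc 2 i)))

size-suc-suc : ∀ i d → size (suc i) d ≡ size i (2 + d)
size-suc-suc i d = sym (trans (size-suc i (suc d)) (cong suc (size-suc i d)))

size-lower : ∀ {i j} d → j ≤ i → ∃ λ c → size i d ≡ size j c
size-lower d z≤n = _ , refl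
size-lower d (s≤s j≤i) = let c , eq = size-lower d j≤i in c , cong (λ n → 2 + n) eq

-- The top genus of words on `m` letters is the half `i`; the remainder `d` bounds how far `m`
-- exceeds `size i 0`.
halve : ∀ m → ∃₂ λ i d → m ≡ size i d × d ≤ 1
halve zero          = 0 , 0 , refl , z≤n
halve (suc zero)    = 0 , 1 , refl , s≤s z≤n
halve (suc (suc m)) = let i , d , eq , d≤1 = halve m in suc i , d , cong (λ n → 2 + n) eq , d≤1

genusCount-term : ∀ {m} i d → m ≡ size i d → genusCount (suc m) (suc i) ≡ 4 * term i d
genusCount-term {m} i d refl = trans (genusCount-framedCount (suc m) (suc i)) (framedCount-suc m i)

genusCount-vanishes : ∀ {m i} → m < size i 0 → genusCount (suc m) (suc i) ≡ 0
genusCount-vanishes {m} {i} m< = trans (genusCount-framedCount (suc m) (suc i))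
  (trans (framedCount-suc m i) (cong (4 *_) (wordCount-vanishes m i m<)))

genusCount-0 : ∀ m → genusCount (suc m) 0 ≡ 0
genusCount-0 m = trans (genusCount-framedCount (suc m) 0) (framedCount-0 m)

module _ (m r e : ℕ) (m≡ : m ≡ size r e) (e≤1 : e ≤ 1) where

  private
    f : ℕ → ℕ
    f = genusCount (suc m)

    t : ℕ
    t = suc m / 3

    fit : ∀ {i} → i ≤ r → ∃ λ d → m ≡ size i d
    fit i≤r = let d , eq = size-lower e i≤r in d , trans m≡ eq

    f-term : ∀ i d → m ≡ size i d → f (suc i) ≡ 4 * term i d
    f-term = genusCount-term

    f-positive : ∀ {i} → i ≤ r → 0 < f (suc i)
    f-positive {i} i≤r = let d , eq = fit i≤r in
      subst (0 <_) (sym (f-term i d eq)) (ℕ.<-≤-trans (term-positive i d) (ℕ.m≤m+n _ _))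

    beyond : ∀ {i} → r < i → m < size i 0
    beyond {i} r<i = begin-strict
      m               ≡⟨ trans m≡ (size-≡ r e) ⟩
      2 * r + e       ≤⟨ ℕ.+-monoʳ-≤ (2 * r) e≤1 ⟩
      2 * r + 1       <⟨ ℕ.+-monoʳ-< (2 * r) (s≤s (s≤s z≤n)) ⟩
      2 * r + 2       ≡⟨ trans (ℕ.+-comm (2 * r) 2) (sym (ℕ.*-suc 2 r)) ⟩
      2 * suc r       ≤⟨ ℕ.*-monoʳ-≤ 2 r<i ⟩
      2 * i           ≡⟨ ℕ.+-identityʳ (2 * i) ⟨
      2 * i + 0       ≡⟨ size-≡ i 0 ⟨
      size i 0        ∎
      where open ℕ.≤-Reasoning

  minGenus : IsMinGenus (suc m) 1
  minGenus = f-positive z≤n , λ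
    { zero    0<f → contradiction (genusCount-0 m) (λ eq → ℕ.<⇒≢ 0<f (sym eq))
    ; (suc i) _   → s≤s z≤n }

  maxGenus : IsMaxGenus (suc m) (suc r)
  maxGenus = f-positive ℕ.≤-refl , λ
    { zero    _   → z≤n
    ; (suc i) 0<f → s≤s (ℕ.≮⇒≥ λ r<i → ℕ.<⇒≢ 0<f (sym (genusCount-vanishes {m} {i} (beyond r<i)))) }

  logConcave : LogConcave f 1 (suc r)
  logConcave (suc i) _ (s≤s 2+i≤r) =
    let d , eq = fit 2+i≤r
        eq₁    = trans eq (size-suc-suc (suc i) d)
        eq₀    = trans eq₁ (size-suc-suc i (2 + d))
    in subst₂ _≤_
      (trans (regroup₁ (term i (4 + d)) (term (2 + i) d)) (sym (cong₂ _*_ (f-term i (4 + d) eq₀) (f-term (2 + i) d eq))))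
      (trans (regroup₂ (term (1 + i) (2 + d))) (cong (_^ 2) (sym (f-term (1 + i) (2 + d) eq₁))))
      (ℕ.*-monoʳ-≤ 16 (term-logConcave i d))
    where
    regroup₁ : ∀ x y → 16 * (x * y) ≡ (4 * x) * (4 * y)
    regroup₁ = solve-∀
    regroup₂ : ∀ x → 16 * (x * (x * 1)) ≡ (4 * x) * ((4 * x) * 1)
    regroup₂ = solve-∀

  private
    1+m≡ : ∀ {i d} → m ≡ size (suc i) d → suc m ≡ (2 * i + 3) + d
    1+m≡ {i} {d} eq = trans (cong suc (trans eq (size-≡ (suc i) d))) (regroup i d)
      where
      regroup : ∀ i d → 1 + (2 * (1 + i) + d) ≡ (2 * i + 3) + d
      regroup = solve-∀

    *3≡ : ∀ i → suc i * 3 ≡ (2 * i + 3) + i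
    *3≡ = solve-∀

    -- With n = `suc m` one has n = 2i + 3 + d and 3(i + 1) = 2i + 3 + i. Comparing i + 1 with n / 3
    -- thus amounts to comparing `i` with `d`, which is where the ratio crosses 1.
    before : ∀ {i d} → m ≡ size (suc i) d → suc i ≤ t → i ≤ d
    before {i} {d} eq i<t = ℕ.+-cancelˡ-≤ (2 * i + 3) i d
      (subst₂ _≤_ (*3≡ i) (1+m≡ {i} {d} eq) (ℕ.≤-trans (ℕ.*-monoˡ-≤ 3 i<t) (m/n*n≤m (suc m) 3)))

    after : ∀ {i d} → m ≡ size (suc i) d → t ≤ i → d < i
    after {i} {d} eq t≤i = ℕ.+-cancelˡ-< (2 * i + 3) d i
      (subst₂ _<_ (1+m≡ {i} {d} eq) (*3≡ i) (ℕ.<-≤-trans (begin-strict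
        suc m                   ≡⟨ m≡m%n+[m/n]*n (suc m) 3 ⟩
        suc m % 3 + t * 3       <⟨ ℕ.+-monoˡ-< (t * 3) (m%n<n (suc m) 3) ⟩
        suc t * 3               ∎)
        (ℕ.*-monoˡ-≤ 3 (s≤s t≤i))))
      where open ℕ.≤-Reasoning

    -- Otherwise 3(r + 1) would be at most n, which is at most 2r + 2.
    t≤r : t ≤ r
    t≤r = ℕ.≮⇒≥ λ r<t → ℕ.<-irrefl refl (begin-strict
      suc m             ≡⟨ cong suc (trans m≡ (size-≡ r e)) ⟩
      suc (2 * r + e)   ≤⟨ s≤s (ℕ.+-monoʳ-≤ (2 * r) e≤1) ⟩
      suc (2 * r + 1)   ≡⟨ ℕ.+-suc (2 * r) 1 ⟨
      2 * r + 2         <⟨ ℕ.+-monoʳ-< (2 * r) (s≤s (s≤s (s≤s z≤n))) ⟩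
      2 * r + 3         ≤⟨ ℕ.m≤m+n (2 * r + 3) r ⟩
      (2 * r + 3) + r   ≡⟨ *3≡ r ⟨
      suc r * 3         ≤⟨ ℕ.*-monoˡ-≤ 3 r<t ⟩
      t * 3             ≤⟨ m/n*n≤m (suc m) 3 ⟩
      suc m             ∎)
      where open ℕ.≤-Reasoning

    step-terms : ∀ {i} → suc i ≤ r → ∃ λ d → m ≡ size (suc i) d ×
                 f (suc i) ≡ 4 * term i (2 + d) × f (2 + i) ≡ 4 * term (suc i) d
    step-terms {i} i<r = let d , eq = fit i<r in
      d , eq , f-term i (2 + d) (trans eq (size-suc-suc i d)) , f-term (suc i) d eq

    f-ascending : ∀ {i} → suc i ≤ r → suc i ≤ t → f (suc i) ≤ f (2 + i)
    f-ascending {i} i<r i<t = let d , eq , eq₀ , eq₁ = step-terms i<r in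
      subst₂ _≤_ (sym eq₀) (sym eq₁) (ℕ.*-monoʳ-≤ 4 (term-ascending {i} {d} (before eq i<t)))

    -- The tie `i = d = 0` occurs only in the row of n = 3.
    gap : ∀ {i d} → suc m ≢ 3 → m ≡ size (suc i) d → i ≤ d → 0 < d
    gap {d = suc d} _  _  _   = s≤s z≤n
    gap {d = zero}  ≢3 eq z≤n = contradiction (cong suc eq) ≢3

    f-rise : ∀ {i} → suc m ≢ 3 → suc i ≤ r → suc i ≤ t → f (suc i) < f (2 + i)
    f-rise {i} ≢3 i<r i<t = let d , eq , eq₀ , eq₁ = step-terms i<r; i≤d = before eq i<t in
      subst₂ _<_ (sym eq₀) (sym eq₁) (ℕ.*-monoʳ-< 4 (term-rise {i} {d} i≤d (gap ≢3 eq i≤d)))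

    f-fall : ∀ {i} → suc i ≤ r → t ≤ i → f (2 + i) < f (suc i)
    f-fall {i} i<r t≤i = let d , eq , eq₀ , eq₁ = step-terms i<r in
      subst₂ _<_ (sym eq₁) (sym eq₀) (ℕ.*-monoʳ-< 4 (term-fall {i} {d} (after eq t≤i)))

  unimodal : suc m ≢ 3 → UnimodalWithModes f 1 (suc r) (suc t) (suc t)
  unimodal ≢3 = record
    { q≤l        = s≤s z≤n
    ; l≤m        = ℕ.≤-refl
    ; m≤r        = s≤s t≤r
    ; ascending  = λ { (suc i) _ (s≤s 1+i<t) → let i<t = ℕ.<⇒≤ 1+i<t in f-ascending (ℕ.≤-trans i<t t≤r) i<t }
    ; rise       = λ { (suc i) _ eq → rise′ (ℕ.suc-injective eq) }
    ; plateau    = λ i t<i i≤t → contradiction t<i (ℕ.<⇒≱ i≤t)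
    ; fall       = λ { (s≤s t<r) → f-fall t<r ℕ.≤-refl }
    ; descending = λ { (suc i) (s≤s t<i) (s≤s i<r) → ℕ.<⇒≤ (f-fall i<r (ℕ.<⇒≤ t<i)) }
    }
    where
    rise′ : ∀ {i} → suc i ≡ t → f (suc i) < f (suc t)
    rise′ {i} eq = subst (λ l → f (suc i) < f (suc l)) eq
      (f-rise ≢3 (subst (_≤ r) (sym eq) t≤r) (ℕ.≤-reflexive eq))

-- The number of letters stays a variable, since Agda would evaluate genusCount 3.
unimodal-3 : ∀ {m} → m ≡ 2 → UnimodalWithModes (genusCount (suc m)) 1 2 1 2
unimodal-3 {m} m≡2 = record
  { q≤l        = s≤s z≤n
  ; l≤m        = s≤s z≤n
  ; m≤r        = ℕ.≤-refl
  ; ascending  = λ { i q≤i (s≤s ()) }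
  ; rise       = λ { (suc i) q≤i () }
  -- Both `4 * term 0 2` and `4 * term 1 0` evaluate to 32.
  ; plateau    = λ { (suc zero) _ _ → trans (genusCount-term 0 2 m≡2) (sym (genusCount-term 1 0 m≡2))
                   ; (suc (suc i)) _ (s≤s (s≤s ())) }
  ; fall       = λ { (s≤s (s≤s ())) }
  ; descending = λ i 3≤i 1+i≤2 → contradiction (ℕ.≤-trans 3≤i (ℕ.≤-trans (ℕ.n≤1+n i) 1+i≤2)) λ { (s≤s (s≤s ())) }
  }

corollary3p4 : (n : ℕ) → 1 ≤ n →
    ∃₂ λ q r →
    IsMinGenus n q × IsMaxGenus n r
    × LogConcave (genusCount n) q r
    × (n ≡ 3 → UnimodalWithModes (genusCount n) q r 1 2)
    × (n ≢ 3 → UnimodalWithModes (genusCount n) q r (n / 3 + 1) (n / 3 + 1))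
corollary3p4 (suc m) _ =
  let r , e , m≡ , e≤1 = halve m in
  1 , suc r , minGenus m r e m≡ e≤1 , maxGenus m r e m≡ e≤1 , logConcave m r e m≡ e≤1
  -- Only the upper bound is transported along `m≡2`; `genusCount` keeps its variable argument.
  , (λ ≡3 → let m≡2 = ℕ.suc-injective ≡3 in
       subst (λ m′ → UnimodalWithModes (genusCount (suc m)) 1 (suc (proj₁ (halve m′))) 1 2)
         (sym m≡2) (unimodal-3 m≡2))
  , λ ≢3 → subst (λ l → UnimodalWithModes (genusCount (suc m)) 1 (suc r) l l)
             (ℕ.+-comm 1 (suc m / 3)) (unimodal m r e m≡ e≤1 ≢3)
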